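{- Let $\ell \geqslant 1$ and let $A = \{0 = a_0 < a_1 < \cdots < a_{\ell+1} = b\}$ be a finite set of integers with $\gcd(a_1,\dots,a_{\ell+1}) = 1$. If $N$ is an integer with $N \geqslant \max(1,b-\ell-1)$, then $$NA = \{0,1,\dots,bN\} \setminus \big( \mathcal{E}(A) \cup (bN - \mathcal{E}(b-A))\big),$$ unless either $A$ or $b-A$ is a set in one of the following two families: (i) $\{0,1,\dots,b\}\setminus\{a\}$ for some integer $a$ with $2\leqslant a\leqslant b-2$; (ii) $\{0,1,a+1,a+2,\dots,b-1,b\}$ for some integer $a$ with $2\leqslant a\leqslant b-2$.
   Context: For a finite set of integers $A$ and an integer $N\geqslant 1$, $NA := \{x_1+\cdots+x_N : x_1,\dots,x_N\in A\}$ is the $N$-fold sumset (summands not necessarily distinct). For a finite set $A$ of non-negative integers containing $0$, $\mathcal{P}(A) := \bigcup_{N=1}^{\infty} NA$ and $\mathcal{E}(A) := \{n \geqslant 1 : n \text{ an integer},\ n\notin \mathcal{P}(A)\}$. For an integer $m$ and a set $S$ of integers, $m - S := \{m-s : s\in S\}$; thus $b-A=\{b-a: a\in A\}$, which is again a finite set of non-negative integers containing $0$ with maximum $b$. "The equality holds unless $A$ or $b-A$ is in a family" means: if neither $A$ nor $b-A$ is a member of family (i) or (ii), then the equality holds. -}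

module Defs where

open import Data.Integer.Base using (ℤ; +_; 0ℤ; 1ℤ; _+_; _-_; _≤_)
open import Data.Integer.GCD using (gcd)
open import Data.Nat.Base as ℕ using (ℕ)
open import Data.Product.Base using (_×_; ∃-syntax; Σ-syntax)
open import Data.Vec.Functional using (Vector; foldr)
open import Data.Vec.Functional.Relation.Unary.All using (All)
open import Level using (0ℓ)
open import Relation.Binary.PropositionalEquality.Core using (_≡_)
open import Relation.Unary using (Pred; _∈_; _∉_; _≐_; _∪_; _∖_; ｛_｝)

ℤSet : Set₁
ℤSet = Pred ℤ 0ℓ

image : ∀ {n} → Vector ℤ n → ℤSet
image a x = ∃[ i ] a i ≡ x

-- 0ℤ is the unit of gcd, so for n ≥ 1 this is the usual gcd of the n entries.
gcdᵛ : ∀ {n} → Vector ℤ n → ℤ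
gcdᵛ = foldr gcd 0ℤ

sumᵛ : ∀ {n} → Vector ℤ n → ℤ
sumᵛ = foldr _+_ 0ℤ

infixr 8 _·_
infixl 7 _⊖_

-- The N-fold sumset NA (not the dilate of A by N).
_·_ : ℕ → ℤSet → ℤSet
(N · A) x = Σ[ xs ∈ Vector ℤ N ] All A xs × sumᵛ xs ≡ x

-- The reflected set m - S = { m - s : s ∈ S }.
_⊖_ : ℤ → ℤSet → ℤSet
(m ⊖ S) x = ∃[ s ] s ∈ S × m - s ≡ x

𝓟 : ℤSet → ℤSet
𝓟 A x = ∃[ N ] 1 ℕ.≤ N × x ∈ N · A

𝓔 : ℤSet → ℤSet
𝓔 A n = 1ℤ ≤ n × n ∉ 𝓟 A

[_⋯_] : ℤ → ℤ → ℤSet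
[ p ⋯ q ] x = p ≤ x × x ≤ q

FamilyI : ℤ → ℤSet → Set
FamilyI b A = ∃[ a ] + 2 ≤ a × a ≤ b - + 2 × A ≐ [ 0ℤ ⋯ b ] ∖ ｛ a ｝

FamilyII : ℤ → ℤSet → Set
FamilyII b A = ∃[ a ] + 2 ≤ a × a ≤ b - + 2 × A ≐ ｛ 0ℤ ｝ ∪ ｛ 1ℤ ｝ ∪ [ a + 1ℤ ⋯ b ]

{-# OPTIONS --safe #-}
module Submission where

-- For an interior element a of A put X = a and Y = b - a.  Let x + y = bN.  A list of interior
-- elements with ΣX ≡ x (mod b), ΣX ≤ x and ΣY ≤ y shows x ∈ NA: pad it with copies of b and 0.
-- If x ∉ 𝓔(A) and y ∉ 𝓔(b - A), there are "low" lists (ΣX ≤ x) and "high" lists (ΣY ≤ y) in this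
-- residue class.  Suppose that no list is both.  Let l be the least length of a high list; exchanging
-- A and b - A if necessary, some low list has length at most l.
--
-- Take a low list ω ++ α of length at most l and a high list ω ++ γ of length l, with the lengths of
-- α and then of ω minimal.  The sums of prefixes with at least two terms of either list avoid A modulo
-- b and are distinct, since otherwise the list could be shortened.  If proper prefixes of α and γ have
-- congruent sums, exchanging them leads to a smaller pair.  As b - ℓ - 1 residues lie outside A, while
-- adding up the coordinates gives |ω ++ α| + |ω ++ γ| ≥ N + 3 + |ω|, pigeonhole leaves only the case
-- where ω is empty, N = b - ℓ - 1, ΣX α + ΣY γ = b, and the prefix sums are all of the complement of A.
-- In that case α (γ) has two terms or consists of copies of 1 (of b - 1), so A is in a family.

open import Defs

module Combinatorics where

  open import Data.Empty using (⊥; ⊥-elim)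
  open import Data.Fin.Base using (Fin; fromℕ<; toℕ)
  open import Data.Fin.Properties using (injective⇒≤; toℕ-fromℕ<)
  open import Data.List.Base using (List; []; _∷_; _++_; length; lookup; map; take; drop; applyUpTo; tabulate)
  open import Data.List.Membership.Propositional using (_∈_)
  open import Data.List.Membership.Propositional.Properties using (∈-lookup; ∈-++⁻; ∈-∃++; ∈-tabulate⁻; ∈-applyUpTo⁻)
  open import Data.List.Properties using (∷-injective; map-++; ++-assoc; ++-identityʳ; length-++; length-tabulate; length-applyUpTo; take++drop≡id; take-all; length-take; length-drop)
  open import Data.List.Relation.Binary.Permutation.Propositional using (_↭_; ↭-refl; ↭-sym; ↭-reflexive; ↭-trans)
  import Data.List.Relation.Binary.Permutation.Propositional.Properties as ↭
  open import Data.List.Relation.Unary.All as All using (All; []; _∷_)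
  import Data.List.Relation.Unary.All.Properties as All
  open import Data.List.Relation.Unary.AllPairs using ([]; _∷_)
  open import Data.List.Relation.Unary.Any using (here; there)
  open import Data.List.Relation.Unary.Unique.Propositional using (Unique)
  import Data.List.Relation.Unary.Unique.Propositional.Properties as Unique
  open import Data.Nat.Base
  open import Data.Nat.DivMod
  open import Data.Nat.ListAction using (sum)
  open import Data.Nat.ListAction.Properties using (sum-++; sum-↭)
  open import Data.Nat.Properties
  open import Data.Nat.Tactic.RingSolver using (solve-∀)
  open import Data.List.Membership.DecPropositional _≟_ using (_∈?_)
  open import Data.Product.Base using (_×_; _,_; ∃; ∃₂; proj₁; proj₂)
  open import Data.Sum.Base using (_⊎_; inj₁; inj₂; [_,_]′)
  open import Function.Base using (_∘_)
  open import Function.Bundles using (_⇔_; mk⇔)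
  open import Relation.Binary.PropositionalEquality
  open import Relation.Nullary using (¬_; Dec; yes; no; contradiction)

  -- Congruence of natural numbers modulo `b`.

  module Congruence (b : ℕ) where

    infix 4 _≈_
    -- Multiples of `b` may be added on both sides, which avoids truncated subtraction and makes the
    -- relation visibly symmetric.
    _≈_ : ℕ → ℕ → Set
    m ≈ n = ∃₂ λ i j → m + i * b ≡ n + j * b

    ≈-reflexive : ∀ {m n} → m ≡ n → m ≈ n
    ≈-reflexive refl = 0 , 0 , refl

    ≈-sym : ∀ {m n} → m ≈ n → n ≈ m
    ≈-sym (i , j , eq) = j , i , sym eq

    private
      shuffle : ∀ m n p q b → (m + n) + (p + q) * b ≡ (m + p * b) + (n + q * b)
      shuffle = solve-∀

    ≈-+ : ∀ {m n m′ n′} → m ≈ n → m′ ≈ n′ → m + m′ ≈ n + n′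
    ≈-+ {m} {n} {m′} {n′} (i , j , eq) (i′ , j′ , eq′) = i + i′ , j + j′ , (begin
      (m + m′) + (i + i′) * b        ≡⟨ shuffle m m′ i i′ b ⟩
      (m + i * b) + (m′ + i′ * b)    ≡⟨ cong₂ _+_ eq eq′ ⟩
      (n + j * b) + (n′ + j′ * b)    ≡⟨ shuffle n n′ j j′ b ⟨
      (n + n′) + (j + j′) * b        ∎)
      where open ≡-Reasoning

    ≈-cancelˡ : ∀ k {m n} → k + m ≈ k + n → m ≈ n
    ≈-cancelˡ k {m} {n} (i , j , eq) = i , j , +-cancelˡ-≡ k _ _
      (trans (sym (+-assoc k m (i * b))) (trans eq (+-assoc k n (j * b))))

    ≈-trans : ∀ {m n o} → m ≈ n → n ≈ o → m ≈ o
    ≈-trans {m} {n} {o} m≈n n≈o =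
      ≈-cancelˡ n (subst (_≈ n + o) (+-comm m n) (≈-+ m≈n n≈o))

    -- This carries congruences between `X`-sums and `Y`-sums, whose totals are multiples of `b`.
    ≈-complement : ∀ {m n m′ n′} → m + m′ ≈ n + n′ → m ≈ n → m′ ≈ n′
    ≈-complement {m} {n} {m′} {n′} s m≈n =
      ≈-cancelˡ m (≈-trans s (≈-+ (≈-sym m≈n) (≈-reflexive refl)))

    *b≈0 : ∀ n → n * b ≈ 0
    *b≈0 n = 0 , n , +-identityʳ (n * b)

    b≈0 : ∀ {m} → m ≡ b → m ≈ 0
    b≈0 m≡b = 0 , 1 , cong (_+ 0) m≡b

    -- If `i ≤ j`, the side of `n` would be strictly larger. So `i` exceeds `j`, and the extra copy
    -- of `b` is the gap. Every violated bound on a sum thereby gains a whole `b`.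
    ≈∧<⇒+b≤ : ∀ {m n} → m ≈ n → m < n → m + b ≤ n
    ≈∧<⇒+b≤ {m} {n} (i , j , eq) m<n with i ≤? j
    ... | yes i≤j = contradiction eq (<⇒≢ (+-mono-<-≤ m<n (*-monoˡ-≤ b i≤j)))
    ... | no  i≰j = +-cancelʳ-≤ (j * b) _ _ (begin
      m + b + j * b    ≡⟨ +-assoc m b (j * b) ⟩
      m + suc j * b    ≤⟨ +-monoʳ-≤ m (*-monoˡ-≤ b (≰⇒> i≰j)) ⟩
      m + i * b        ≡⟨ eq ⟩
      n + j * b        ∎)
      where open ≤-Reasoning

    ≈⇒≡+* : ∀ {m n} → m ≈ n → m ≤ n → ∃ λ i → n ≡ m + i * b
    ≈⇒≡+* {m} {n} (i , j , eq) m≤n with j ≤? i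
    ... | yes j≤i = i ∸ j , +-cancelʳ-≡ (j * b) _ _ (begin
      n + j * b                     ≡⟨ eq ⟨
      m + i * b                     ≡⟨ cong (λ t → m + t * b) (m∸n+n≡m j≤i) ⟨
      m + (i ∸ j + j) * b           ≡⟨ cong (m +_) (*-distribʳ-+ b (i ∸ j) j) ⟩
      m + ((i ∸ j) * b + j * b)     ≡⟨ +-assoc m _ _ ⟨
      m + (i ∸ j) * b + j * b       ∎)
      where open ≡-Reasoning
    ... | no  j≰i = 0 , trans (≤-antisym n≤m m≤n) (sym (+-identityʳ m))
      where
      n≤m : n ≤ m
      n≤m = +-cancelʳ-≤ (j * b) _ _ (≤-trans (≤-reflexive (sym eq)) (+-monoʳ-≤ m (*-monoˡ-≤ b (<⇒≤ (≰⇒> j≰i)))))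

    ≈∧<b⇒≤ : ∀ {m n} → m ≈ n → m < b → m ≤ n
    ≈∧<b⇒≤ {m} {n} m≈n m<b with m ≤? n
    ... | yes m≤n = m≤n
    ... | no  m≰n = contradiction (≤-trans (m≤n+m b n) (≈∧<⇒+b≤ (≈-sym m≈n) (≰⇒> m≰n))) (<⇒≱ m<b)

    module _ .{{_ : NonZero b}} where

      %-≈ : ∀ m → m % b ≈ m
      %-≈ m = m / b , 0 , trans (sym (m≡m%n+[m/n]*n m b)) (sym (+-identityʳ m))

      %≡⇒≈ : ∀ {m n} → m % b ≡ n % b → m ≈ n
      %≡⇒≈ {m} {n} eq = ≈-trans (≈-sym (%-≈ m)) (≈-trans (≈-reflexive eq) (%-≈ n))

  -- Pigeonhole for lists of distinct numbers.

  Unique-lookup-injective : ∀ {xs : List ℕ} → Unique xs → ∀ i j → lookup xs i ≡ lookup xs j → i ≡ j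
  Unique-lookup-injective (_ ∷ _)  Fin.zero    Fin.zero    _  = refl
  Unique-lookup-injective (p ∷ _)  Fin.zero    (Fin.suc j) eq = contradiction eq (All.lookup p (∈-lookup j))
  Unique-lookup-injective (p ∷ _)  (Fin.suc i) Fin.zero    eq = contradiction (sym eq) (All.lookup p (∈-lookup i))
  Unique-lookup-injective (_ ∷ us) (Fin.suc i) (Fin.suc j) eq = cong Fin.suc (Unique-lookup-injective us i j eq)

  Unique-bounded : ∀ {n} {xs : List ℕ} → Unique xs → All (_< n) xs → length xs ≤ n
  Unique-bounded {n} {xs} uniq bnd = injective⇒≤ {f = f} λ {i} {j} eq → Unique-lookup-injective uniq i j
    (trans (sym (toℕ-fromℕ< _)) (trans (cong toℕ eq) (toℕ-fromℕ< _)))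
    where
    f : Fin (length xs) → Fin n
    f i = fromℕ< (All.lookup bnd (∈-lookup i))

  -- A missing `v` could be put in front, giving more than `n` distinct numbers below `n`.
  Unique-exhaustive : ∀ {n} {xs : List ℕ} → Unique xs → All (_< n) xs → n ≤ length xs →
                      ∀ {v} → v < n → v ∈ xs
  Unique-exhaustive {n} {xs} uniq bnd n≤ {v} v<n with v ∈? xs
  ... | yes v∈ = v∈
  ... | no  v∉ = contradiction (≤-trans (s≤s n≤) (Unique-bounded (v-fresh ∷ uniq) (v<n ∷ bnd))) (<-irrefl refl)
    where
    v-fresh : All (v ≢_) xs
    v-fresh = All.tabulate λ w∈ v≡w → v∉ (subst (_∈ xs) (sym v≡w) w∈)

  -- Factorisations of lists and sums over them.

  module _ {a} {A : Set a} where

    -- This locates the cut after `ps` relative to the cut after `us`. The second case has a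
    -- nonempty overlap, so coinciding cuts fall under the first.
    ++-split : ∀ (us {vs} ps {qs} : List A) → us ++ vs ≡ ps ++ qs →
               (∃ λ ts → us ≡ ps ++ ts × qs ≡ ts ++ vs) ⊎
               (∃ λ ts → ps ≡ us ++ ts × vs ≡ ts ++ qs × 0 < length ts)
    ++-split us       []       eq   = inj₁ (us , refl , sym eq)
    ++-split []       (p ∷ ps) eq   = inj₂ (p ∷ ps , refl , eq , z<s)
    ++-split (u ∷ us) (p ∷ ps) eq with refl , _ ← ∷-injective eq | ++-split us ps (proj₂ (∷-injective eq))
    ... | inj₁ (ts , refl , eq₂)      = inj₁ (ts , refl , eq₂)
    ... | inj₂ (ts , refl , eq₂ , t>) = inj₂ (ts , refl , eq₂ , t>)

    take-+ : ∀ i j (us : List A) → take (i + j) us ≡ take i us ++ take j (drop i us)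
    take-+ zero    j us       = refl
    take-+ (suc i) zero    []       = refl
    take-+ (suc i) (suc j) []       = refl
    take-+ (suc i) j (u ∷ us) = cong (u ∷_) (take-+ i j us)

    Σ : (A → ℕ) → List A → ℕ
    Σ f us = sum (map f us)

    Σ-++ : ∀ f us vs → Σ f (us ++ vs) ≡ Σ f us + Σ f vs
    Σ-++ f us vs = trans (cong sum (map-++ f us vs)) (sum-++ (map f us) (map f vs))

    Σ-↭ : ∀ f {us vs} → us ↭ vs → Σ f us ≡ Σ f vs
    Σ-↭ f p = sum-↭ (↭.map⁺ f p)

    Σ-≥length : ∀ f → (∀ u → 0 < f u) → ∀ us → length us ≤ Σ f us
    Σ-≥length f pos []       = z≤n
    Σ-≥length f pos (u ∷ us) = +-mono-≤ (pos u) (Σ-≥length f pos us)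

    Σ-take-≤ : ∀ f i us → Σ f (take i us) ≤ Σ f us
    Σ-take-≤ f i us = subst (Σ f (take i us) ≤_)
      (trans (sym (Σ-++ f (take i us) (drop i us))) (cong (Σ f) (take++drop≡id i us))) (m≤m+n _ _)

    length-prefix : ∀ {i} {us : List A} → i ≤ length us → length (take i us) ≡ i
    length-prefix {i} {us} i≤ = trans (length-take i us) (m≤n⇒m⊓n≡m i≤)

  i<n∸m⇒m+i<n : ∀ m {i n} → i < n ∸ m → m + i < n
  i<n∸m⇒m+i<n zero            i< = i<
  i<n∸m⇒m+i<n (suc m) {n = suc n} i< = s≤s (i<n∸m⇒m+i<n m i<)

  -- Interior elements of `A` (as `X`) and of `b - A` (as `Y`).

  record System (ℓ b : ℕ) : Set where
    field
      X Y         : Fin ℓ → ℕ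
      X+Y≡b       : ∀ e → X e + Y e ≡ b
      X>0         : ∀ e → 0 < X e
      Y>0         : ∀ e → 0 < Y e
      X-injective : ∀ {e f} → X e ≡ X f → e ≡ f

    X<b : ∀ e → X e < b
    X<b e = subst (X e <_) (X+Y≡b e) (m<m+n (X e) (Y>0 e))

  -- Counting residues modulo `b`.

  module Residues {ℓ b : ℕ} .{{_ : NonZero b}} (S : System ℓ b) where
    open System S
    open Congruence b

    Avoids : (ℕ → ℕ) → ℕ → Set
    Avoids f n = ∀ i → i < n → ¬ f i ≈ 0 × (∀ e → ¬ f i ≈ X e)

    Distinct : (ℕ → ℕ) → ℕ → Set
    Distinct f n = ∀ i j → i < j → j < n → ¬ f i ≈ f j

    -- The classes of `A`, with `b` merged into 0, come first. If the whole list is free of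
    -- repetitions, it has at most `b` entries; since `b ≤ 1 + ℓ + N` in the applications, this
    -- leaves `m + n ≤ N`.
    residues : (ℕ → ℕ) → ℕ → (ℕ → ℕ) → ℕ → List ℕ
    residues f m g n = (0 ∷ tabulate X) ++ applyUpTo (λ i → f i % b) m ++ applyUpTo (λ i → g i % b) n

    length-residues : ∀ f m g n → length (residues f m g n) ≡ suc (ℓ + (m + n))
    length-residues f m g n = cong suc (trans (length-++ (tabulate X)) (cong₂ _+_ (length-tabulate X)
      (trans (length-++ (applyUpTo _ m)) (cong₂ _+_ (length-applyUpTo _ m) (length-applyUpTo _ n)))))

    residues-bounded : ∀ f m g n → All (_< b) (residues f m g n)
    residues-bounded f m g n = All.++⁺ (>-nonZero⁻¹ b ∷ All.tabulate⁺ X<b)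
      (All.++⁺ (All.applyUpTo⁺₂ _ m (λ i → m%n<n (f i) b)) (All.applyUpTo⁺₂ _ n (λ i → m%n<n (g i) b)))

    residues-unique : ∀ f m g n → Avoids f m → Distinct f m → Avoids g n → Distinct g n →
                      (∀ i j → i < m → j < n → ¬ f i ≈ g j) → Unique (residues f m g n)
    residues-unique f m g n af df ag dg fg = Unique.++⁺
      (All.tabulate⁺ (λ e 0≡ → <⇒≢ (X>0 e) 0≡) ∷ Unique.tabulate⁺ X-injective)
      (Unique.++⁺ (distinct df) (distinct dg) f#g)
      A#fg
      where
      distinct : ∀ {h k} → Distinct h k → Unique (applyUpTo (λ i → h i % b) k)
      distinct {h} {k} d = Unique.applyUpTo⁺₁ _ k λ {i} {j} i<j j<k eq → d i j i<j j<k (%≡⇒≈ eq)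

      f#g : ∀ {v} → ¬ (v ∈ applyUpTo (λ i → f i % b) m × v ∈ applyUpTo (λ i → g i % b) n)
      f#g (p , q) with i , i< , refl ← ∈-applyUpTo⁻ (λ i → f i % b) p
                     | j , j< , eq ← ∈-applyUpTo⁻ (λ i → g i % b) q = fg i j i< j< (%≡⇒≈ eq)

      avoid : ∀ {h k v} → Avoids h k → v ∈ 0 ∷ tabulate X → ¬ v ∈ applyUpTo (λ i → h i % b) k
      avoid {h} {k} a p q with i , i< , eq ← ∈-applyUpTo⁻ (λ i → h i % b) q | p
      ... | here refl = proj₁ (a i i<) (≈-trans (≈-sym (%-≈ (h i))) (≈-reflexive (sym eq)))
      ... | there p′ with e , refl ← ∈-tabulate⁻ p′ =
        proj₂ (a i i<) e (≈-trans (≈-sym (%-≈ (h i))) (≈-reflexive (sym eq)))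

      A#fg : ∀ {v} → ¬ (v ∈ 0 ∷ tabulate X × v ∈ applyUpTo (λ i → f i % b) m ++ applyUpTo (λ i → g i % b) n)
      A#fg (p , q) = [ avoid af p , avoid ag p ]′ (∈-++⁻ (applyUpTo _ m) q)

  -- Low and high lists.

  module Core {ℓ b : ℕ} .{{_ : NonZero b}} (S : System ℓ b) (N x y : ℕ) (x+y≡N*b : x + y ≡ N * b)
              (b≤1+ℓ+N : b ≤ suc (ℓ + N)) where
    open System S
    open Congruence b

    ΣX ΣY : List (Fin ℓ) → ℕ
    ΣX = Σ X
    ΣY = Σ Y

    ΣX+ΣY : ∀ us → ΣX us + ΣY us ≡ length us * b
    ΣX+ΣY []       = refl
    ΣX+ΣY (u ∷ us) = trans (eq (X u) (ΣX us) (Y u) (ΣY us)) (cong₂ _+_ (X+Y≡b u) (ΣX+ΣY us))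
      where
      eq : ∀ p q r s → (p + q) + (r + s) ≡ (p + r) + (q + s)
      eq = solve-∀

    ΣX+ΣY≈0 : ∀ us → ΣX us + ΣY us ≈ 0
    ΣX+ΣY≈0 us = ≈-trans (≈-reflexive (ΣX+ΣY us)) (*b≈0 (length us))

    x+y≈0 : x + y ≈ 0
    x+y≈0 = ≈-trans (≈-reflexive x+y≡N*b) (*b≈0 N)

    ΣY≈y : ∀ {us} → ΣX us ≈ x → ΣY us ≈ y
    ΣY≈y {us} = ≈-complement (≈-trans (ΣX+ΣY≈0 us) (≈-sym x+y≈0))

    Y-singleton : ∀ {us e} → ΣX us ≈ X e → ΣY us ≈ Y e
    Y-singleton {us} {e} = ≈-complement (≈-trans (ΣX+ΣY≈0 us)
      (≈-sym (b≈0 (X+Y≡b e))))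

    record Low (us : List (Fin ℓ)) : Set where
      constructor _&_
      field
        class : ΣX us ≈ x
        bound : ΣX us ≤ x

    -- The class is expressed through `ΣX` here too, so that low and high lists have congruent sums;
    -- `ΣY≈y` converts it to the other coordinate.
    record High (us : List (Fin ℓ)) : Set where
      constructor _&_
      field
        class : ΣX us ≈ x
        bound : ΣY us ≤ y

    Low-↭ : ∀ {us vs} → us ↭ vs → Low us → Low vs
    Low-↭ p (c & le) = subst (_≈ x) (Σ-↭ X p) c & subst (_≤ x) (Σ-↭ X p) le

    High-↭ : ∀ {us vs} → us ↭ vs → High us → High vs
    High-↭ p (c & le) = subst (_≈ x) (Σ-↭ X p) c & subst (_≤ y) (Σ-↭ Y p) le

    ≈0-drop : ∀ ps qs {ss} → ΣX qs ≈ 0 → ΣX (ps ++ ss) ≈ ΣX (ps ++ qs ++ ss)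
    ≈0-drop ps qs {ss} q≈0 = subst₂ _≈_ (sym (Σ-++ X ps ss))
      (sym (trans (Σ-++ X ps (qs ++ ss)) (cong (ΣX ps +_) (Σ-++ X qs ss))))
      (≈-+ {ΣX ps} (≈-reflexive refl) (≈-+ {0} (≈-sym q≈0) (≈-reflexive refl)))

    Σ-drop : ∀ f ps (qs : List (Fin ℓ)) {ss} → Σ f (ps ++ ss) ≤ Σ f (ps ++ qs ++ ss)
    Σ-drop f ps qs {ss} = subst₂ _≤_ (sym (Σ-++ f ps ss))
      (sym (trans (Σ-++ f ps (qs ++ ss)) (cong (Σ f ps +_) (Σ-++ f qs ss))))
      (+-monoʳ-≤ (Σ f ps) (m≤n+m (Σ f ss) (Σ f qs)))

    Low-drop : ∀ ps qs {ss} → ΣX qs ≈ 0 → Low (ps ++ qs ++ ss) → Low (ps ++ ss)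
    Low-drop ps qs q≈0 (c & le) = ≈-trans (≈0-drop ps qs q≈0) c & ≤-trans (Σ-drop X ps qs) le

    High-drop : ∀ ps qs {ss} → ΣX qs ≈ 0 → High (ps ++ qs ++ ss) → High (ps ++ ss)
    High-drop ps qs q≈0 (c & le) = ≈-trans (≈0-drop ps qs q≈0) c & ≤-trans (Σ-drop Y ps qs) le

    ≈-replace : ∀ ps {qs e} → ΣX ps ≈ X e → ΣX (e ∷ qs) ≈ ΣX (ps ++ qs)
    ≈-replace ps {qs} p≈e = subst (_ ≈_) (sym (Σ-++ X ps qs)) (≈-+ (≈-sym p≈e) (≈-reflexive refl))

    -- As `X e < b` is the least member of its class, it is at most the sum of the prefix that it
    -- replaces. `High-replace` uses the same fact for `Y e`.
    Low-replace : ∀ ps {qs e} → ΣX ps ≈ X e → Low (ps ++ qs) → Low (e ∷ qs)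
    Low-replace ps {qs} {e} p≈e (c & le) = ≈-trans (≈-replace ps p≈e) c & ≤-trans
      (subst (X e + ΣX qs ≤_) (sym (Σ-++ X ps qs)) (+-monoˡ-≤ (ΣX qs) (≈∧<b⇒≤ (≈-sym p≈e) (X<b e)))) le

    High-replace : ∀ ps {qs e} → ΣX ps ≈ X e → High (ps ++ qs) → High (e ∷ qs)
    High-replace ps {qs} {e} p≈e (c & le) = ≈-trans (≈-replace ps p≈e) c & ≤-trans
      (subst (Y e + ΣY qs ≤_) (sym (Σ-++ Y ps qs)) (+-monoˡ-≤ (ΣY qs)
        (≈∧<b⇒≤ (≈-sym (Y-singleton {ps} p≈e)) (subst (Y e <_) (X+Y≡b e) (m<n+m (Y e) (X>0 e)))))) le

    -- Consequences of the absence of a list that is both low and high.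

    module Uncovered (uncovered : ∀ us → ΣX us ≈ x → ΣX us ≤ x → ΣY us ≤ y → ⊥) where

      -- A low list must violate the other bound; its `ΣY` is congruent to `y`, so it overshoots by
      -- at least `b`.
      Low⇒ : ∀ {us} → Low us → y + b ≤ ΣY us
      Low⇒ {us} (c & le) = ≈∧<⇒+b≤ (≈-sym (ΣY≈y {us} c)) (≰⇒> (uncovered us c le))

      High⇒ : ∀ {us} → High us → x + b ≤ ΣX us
      High⇒ {us} (c & le) = ≈∧<⇒+b≤ (≈-sym c) (≰⇒> (λ lo → uncovered us c lo le))

      -- A list in the class that violates both bounds overshoots `x` and `y` by `b` each, and its
      -- coordinates then add up to at least `(2 + N) * b`.
      classify : ∀ us → ΣX us ≈ x → Low us ⊎ High us ⊎ 2 + N ≤ length us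
      classify us c with ΣX us ≤? x | ΣY us ≤? y
      ... | yes lo | _      = inj₁ (c & lo)
      ... | no _   | yes hi = inj₂ (inj₁ (c & hi))
      ... | no lo  | no hi  = inj₂ (inj₂ (*-cancelʳ-≤ (2 + N) (length us) b (begin
        (2 + N) * b              ≡⟨ eq N b ⟩
        N * b + (b + b)          ≡⟨ cong (_+ (b + b)) x+y≡N*b ⟨
        x + y + (b + b)          ≡⟨ eq₂ x y b ⟩
        (x + b) + (y + b)        ≤⟨ +-mono-≤ (≈∧<⇒+b≤ (≈-sym c) (≰⇒> lo)) (≈∧<⇒+b≤ (≈-sym (ΣY≈y {us} c)) (≰⇒> hi)) ⟩
        ΣX us + ΣY us            ≡⟨ ΣX+ΣY us ⟩
        length us * b            ∎)))
        where
        open ≤-Reasoning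
        eq : ∀ N b → (2 + N) * b ≡ N * b + (b + b)
        eq = solve-∀
        eq₂ : ∀ x y b → x + y + (b + b) ≡ (x + b) + (y + b)
        eq₂ = solve-∀

      -- Invariant under exchanging (X , α , u) with (Y , γ , v).
      Complete : List (Fin ℓ) → List (Fin ℓ) → Set
      Complete α γ = ∀ u v → u + v ≡ b → 0 < u → 0 < v →
        (∃ λ e → X e ≡ u) ⊎
        (∃ λ i → 2 ≤ i × i ≤ length α × ΣX (take i α) ≡ u) ⊎
        (∃ λ j → 2 ≤ j × j ≤ length γ × ΣY (take j γ) ≡ v)

      -- Putting any e of α last: 1 and ΣX α ∸ 1 cannot both be values of X, and 1 is one,
      -- so ΣX α ∸ 1 is a prefix sum, which leaves a last element of value 1.
      all-ones : ∀ {α γ} → (∀ {α′} → α′ ↭ α → Complete α′ γ) → ΣX α + ΣY γ ≡ b → Low α → ΣY α ≤ y + b →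
                 3 ≤ length α → All (λ e → X e ≡ 1) α
      all-ones {α} {γ} complete sums (cl & bd) ΣYα≤ 3≤α = All.tabulate λ e∈α → last-one e∈α
        where
        open ≤-Reasoning
        r s : ℕ
        r = ΣX α
        s = ΣY γ

        3≤r : 3 ≤ r
        3≤r = ≤-trans 3≤α (Σ-≥length X X>0 α)

        r≡1+ : r ≡ suc (r ∸ 1)
        r≡1+ = sym (m+[n∸m]≡n {1} (≤-trans (s≤s z≤n) 3≤r))

        prefix-γ≤ : ∀ j → ΣY (take j γ) ≤ s
        prefix-γ≤ j = Σ-take-≤ Y j γ

        -- Since `u + v = r + s`, having `u < r` forces `v > s`, beyond every prefix sum of `γ`.
        not-Y : ∀ {u v} j → u + v ≡ b → u < r → ¬ ΣY (take j γ) ≡ v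
        not-Y {u} {v} j u+v≡b u<r refl = <⇒≢ (+-mono-<-≤ u<r (prefix-γ≤ j)) (trans u+v≡b (sym sums))

        last-one : ∀ {e} → e ∈ α → X e ≡ 1
        last-one {e} e∈α with ∈-∃++ e∈α
        ... | ps₁ , ps₂ , refl = finish
          (complete perm 1 (r ∸ 1 + s) eq₁ z<s (≤-trans (s≤s z≤n) (≤-trans 2≤r-1 (m≤m+n _ s))))
          (complete perm (r ∸ 1) (suc s) eq₂ (≤-trans (s≤s z≤n) 2≤r-1) z<s)
          where
          ps α′ : List (Fin ℓ)
          ps = ps₁ ++ ps₂
          α′ = ps ++ e ∷ []

          perm : α′ ↭ ps₁ ++ e ∷ ps₂
          perm = ↭-trans (↭-reflexive (++-assoc ps₁ ps₂ (e ∷ []))) (↭.++⁺ˡ ps₁ (↭.++-comm ps₂ (e ∷ [])))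

          2≤r-1 : 2 ≤ r ∸ 1
          2≤r-1 = s≤s⁻¹ (subst (3 ≤_) r≡1+ 3≤r)

          eq₁ : 1 + (r ∸ 1 + s) ≡ b
          eq₁ = trans (cong (_+ s) (sym r≡1+)) sums

          eq₂ : (r ∸ 1) + suc s ≡ b
          eq₂ = trans (+-suc (r ∸ 1) s) eq₁

          Cases₁ = (∃ λ f → X f ≡ 1) ⊎ (∃ λ i → 2 ≤ i × i ≤ length α′ × ΣX (take i α′) ≡ 1) ⊎
                  (∃ λ j → 2 ≤ j × j ≤ length γ × ΣY (take j γ) ≡ r ∸ 1 + s)
          Cases₂ = (∃ λ f → X f ≡ r ∸ 1) ⊎ (∃ λ i → 2 ≤ i × i ≤ length α′ × ΣX (take i α′) ≡ r ∸ 1) ⊎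
                  (∃ λ j → 2 ≤ j × j ≤ length γ × ΣY (take j γ) ≡ suc s)

          -- The list of `f` and `g` has the same `ΣX` as `α` but at least one term fewer. Its `ΣY`
          -- is therefore smaller by at least `b`, hence at most `y`, and the list would be both low
          -- and high.
          two-terms : ∀ f g → X f ≡ 1 → X g ≡ r ∸ 1 → ⊥
          two-terms f g Xf Xg = uncovered (f ∷ g ∷ []) (subst (_≈ x) (sym sum₂) cl) (subst (_≤ x) (sym sum₂) bd)
            (+-cancelʳ-≤ b _ _ (≤-trans (+-cancelˡ-≤ r _ _ (begin
              r + (ΣY (f ∷ g ∷ []) + b)                    ≡⟨ +-assoc r _ b ⟨
              r + ΣY (f ∷ g ∷ []) + b                      ≡⟨ cong (λ t → t + ΣY (f ∷ g ∷ []) + b) sum₂ ⟨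
              ΣX (f ∷ g ∷ []) + ΣY (f ∷ g ∷ []) + b        ≡⟨ cong (_+ b) (ΣX+ΣY (f ∷ g ∷ [])) ⟩
              2 * b + b                                    ≡⟨ +-comm (2 * b) b ⟩
              3 * b                                        ≤⟨ *-monoˡ-≤ b 3≤α ⟩
              length α * b                                 ≡⟨ ΣX+ΣY α ⟨
              r + ΣY α                                     ∎)) ΣYα≤))
            where
            sum₂ : ΣX (f ∷ g ∷ []) ≡ r
            sum₂ = trans (cong₂ (λ p q → p + (q + 0)) Xf Xg) (trans (cong suc (+-identityʳ (r ∸ 1))) (sym r≡1+))

          drop-one : ∀ i → ΣX (take i α′) ≡ r ∸ 1 → ΣX (drop i α′) ≡ 1
          drop-one i eq = +-cancelˡ-≡ (r ∸ 1) _ _ (begin-equality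
            (r ∸ 1) + ΣX (drop i α′)              ≡⟨ cong (_+ ΣX (drop i α′)) eq ⟨
            ΣX (take i α′) + ΣX (drop i α′)       ≡⟨ Σ-++ X (take i α′) (drop i α′) ⟨
            ΣX (take i α′ ++ drop i α′)           ≡⟨ cong ΣX (take++drop≡id i α′) ⟩
            ΣX α′                                 ≡⟨ Σ-↭ X perm ⟩
            r                                     ≡⟨ r≡1+ ⟩
            suc (r ∸ 1)                           ≡⟨ +-comm 1 (r ∸ 1) ⟩
            (r ∸ 1) + 1                           ∎)

          -- Values are positive, so a tail of sum 1 has exactly one term: the empty tail has sum 0,
          -- and two terms have sum at least 2.
          last-of : ∀ us vs → us ++ vs ≡ ps ++ e ∷ [] → ΣX vs ≡ 1 → X e ≡ 1
          last-of us vs eq one with ++-split us ps eq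
          ... | inj₁ ([] , _ , eq′) with refl ← eq′ = trans (sym (+-identityʳ (X e))) one
          ... | inj₁ (_ ∷ [] , _ , eq′) with refl ← proj₂ (∷-injective eq′) = contradiction one λ ()
          ... | inj₁ (_ ∷ _ ∷ _ , _ , ())
          ... | inj₂ (ts , _ , refl , ts>0) = contradiction
            (≤-trans (≤-trans (s≤s ts>0) (≤-reflexive (sym (trans (length-++ ts) (+-comm (length ts) 1)))))
              (≤-trans (Σ-≥length X X>0 (ts ++ e ∷ [])) (≤-reflexive one))) (<-irrefl refl)

          finish : Cases₁ → Cases₂ → X e ≡ 1
          finish (inj₂ (inj₁ (i , 2≤i , i≤ , eq))) _ = contradiction
            (≤-trans (≤-trans 2≤i (≤-reflexive (sym (length-prefix {us = α′} i≤))))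
                     (≤-trans (Σ-≥length X X>0 (take i α′)) (≤-reflexive eq)))
            (<-irrefl refl)
          finish (inj₂ (inj₂ (j , _ , _ , eq))) _ = ⊥-elim (not-Y j eq₁ (≤-trans (s≤s (s≤s z≤n)) 3≤r) eq)
          finish (inj₁ (f , Xf)) (inj₁ (g , Xg)) = ⊥-elim (two-terms f g Xf Xg)
          finish (inj₁ _) (inj₂ (inj₂ (j , _ , _ , eq))) = ⊥-elim (not-Y j eq₂ (≤-reflexive (sym r≡1+)) eq)
          finish (inj₁ _) (inj₂ (inj₁ (i , _ , _ , eq))) =
            last-of (take i α′) (drop i α′) (take++drop≡id i α′) (drop-one i eq)

      -- What is known of a smallest pair, and enough to determine `A`. `complete` ranges over
      -- rearrangements because `all-ones` moves an arbitrary element to the end.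
      record Terminal (α γ : List (Fin ℓ)) : Set where
        field
          low      : Low α
          high     : High γ
          2≤α      : 2 ≤ length α
          α≤γ      : length α ≤ length γ
          sums     : ΣX α + ΣY γ ≡ b
          ΣYα≤y+b  : ΣY α ≤ y + b
          ΣXγ≤x+b  : ΣX γ ≤ x + b
          complete : ∀ {α′ γ′} → α′ ↭ α → γ′ ↭ γ → Complete α′ γ′
          low-irreducible  : ∀ i e → 2 ≤ i → i ≤ length α → ¬ ΣX (take i α) ≡ X e
          high-irreducible : ∀ j e → 2 ≤ j → j ≤ length γ → ¬ ΣY (take j γ) ≡ Y e

      -- Descent on pairs of a low and a high list.

      module Descent (l : ℕ) (minHigh : ∀ {us} → High us → l ≤ length us) where

        length-drop-< : ∀ (ps qs : List (Fin ℓ)) {ss} → 0 < length qs → length (ps ++ ss) < length (ps ++ qs ++ ss)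
        length-drop-< ps qs {ss} q>0 = subst₂ _<_
          (sym (length-++ ps)) (sym (trans (length-++ ps) (cong (length ps +_) (length-++ qs))))
          (+-monoʳ-< (length ps) (m<n+m (length ss) q>0))

        length-drop-≤ : ∀ (ps qs : List (Fin ℓ)) {ss} → length (ps ++ ss) ≤ length (ps ++ qs ++ ss)
        length-drop-≤ ps qs {ss} = subst₂ _≤_
          (sym (length-++ ps)) (sym (trans (length-++ ps) (cong (length ps +_) (length-++ qs))))
          (+-monoʳ-≤ (length ps) (m≤n+m (length ss) (length qs)))

        -- Together with `minHigh`, `∣high∣` makes the high list a shortest one. `ω` is some shared
        -- part of the two lists, not necessarily the largest.
        record Config (ω α γ : List (Fin ℓ)) : Set where
          constructor config
          field
            low    : Low (ω ++ α)
            high   : High (ω ++ γ)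
            ∣low∣  : length (ω ++ α) ≤ l
            ∣high∣ : length (ω ++ γ) ≡ l

        open Config public

        -- The induction hypothesis for the lexicographic order on (length α , length ω).
        Descends : (ω α : List (Fin ℓ)) → Set
        Descends ω α = ∀ ω′ α′ γ′ → Config ω′ α′ γ′ →
          length α′ < length α ⊎ (length α′ ≤ length α × length ω′ < length ω) → ⊥

        -- Deleting a zero-sum block keeps the list high and would make it shorter than the minimum
        -- `l`.
        high-zero-sum-free : ∀ ps qs {ss} → High (ps ++ qs ++ ss) → length (ps ++ qs ++ ss) ≡ l →
                   0 < length qs → ¬ ΣX qs ≈ 0
        high-zero-sum-free ps qs hi len q>0 q≈0 =
          <⇒≱ (length-drop-< ps qs q>0) (≤-trans (≤-reflexive len) (minHigh (High-drop ps qs q≈0 hi)))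

        high-irreducible : ∀ ps {qs e} → High (ps ++ qs) → length (ps ++ qs) ≡ l →
                   2 ≤ length ps → ¬ ΣX ps ≈ X e
        high-irreducible ps {qs} hi len 2≤p p≈e = <⇒≱ shorter (≤-trans (≤-reflexive len) (minHigh (High-replace ps p≈e hi)))
          where
          shorter : suc (length qs) < length (ps ++ qs)
          shorter = subst (suc (length qs) <_) (sym (length-++ ps)) (+-monoˡ-≤ (length qs) 2≤p)

        module _ {ω α γ} (c : Config ω α γ) (ih : Descends ω α) where

          -- A zero-sum block inside `ω` also occurs in the high list. Any other block meets `α`,
          -- and deleting it from the low list shortens `α`; if the block starts inside `ω`, the
          -- part of `ω` from there on is moved to `γ`.
          low-zero-sum-free : ∀ ps qs {ss} → ω ++ α ≡ ps ++ qs ++ ss → 0 < length qs → ¬ ΣX qs ≈ 0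
          low-zero-sum-free ps qs {ss} eq q>0 q≈0 with ++-split ω ps eq
          ... | inj₁ (ts , refl , eq₁) with ++-split ts qs (sym eq₁)
          ...   | inj₁ (ts′ , refl , refl) = high-zero-sum-free ps qs (subst High assoc (high c))
            (trans (cong length (sym assoc)) (∣high∣ c)) q>0 q≈0
            where
            assoc : (ps ++ qs ++ ts′) ++ γ ≡ ps ++ qs ++ ts′ ++ γ
            assoc = trans (++-assoc ps (qs ++ ts′) γ) (cong (ps ++_) (++-assoc qs ts′ γ))
          ...   | inj₂ (ts′ , refl , refl , ts′>0) = ih ps ss (ts ++ γ)
            (config (Low-drop ps qs q≈0 (subst Low eq (low c)))
                    (subst High (++-assoc ps ts γ) (high c))
                    (≤-trans (length-drop-≤ ps qs) (subst (λ us → length us ≤ l) eq (∣low∣ c)))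
                    (trans (cong length (sym (++-assoc ps ts γ))) (∣high∣ c)))
            (inj₁ (subst (length ss <_) (sym (length-++ ts′)) (m<n+m (length ss) ts′>0)))
          low-zero-sum-free ps qs {ss} eq q>0 q≈0 | inj₂ (ts , refl , refl , _) = ih ω (ts ++ ss) γ
            (config (subst Low (++-assoc ω ts ss) (Low-drop (ω ++ ts) qs q≈0 (subst Low eq (low c))))
                    (high c)
                    (subst (λ us → length us ≤ l) (++-assoc ω ts ss)
                      (≤-trans (length-drop-≤ (ω ++ ts) qs) (subst (λ us → length us ≤ l) eq (∣low∣ c))))
                    (∣high∣ c))
            (inj₁ (length-drop-< ts qs q>0))

          -- A prefix inside `ω` is also a prefix of the high list. A longer one is replaced by `e`
          -- and the shared part is given up: `α` does not grow, and it shrinks if `ω` was empty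
          -- already. This is why `length ω` is the second component of the order.
          low-irreducible : ∀ ps {qs e} → ω ++ α ≡ ps ++ qs → 2 ≤ length ps → ¬ ΣX ps ≈ X e
          low-irreducible ps {qs} {e} eq 2≤p p≈e with ++-split ω ps eq
          ... | inj₁ (ts , refl , refl) = high-irreducible ps (subst High (++-assoc ps ts γ) (high c))
            (trans (cong length (sym (++-assoc ps ts γ))) (∣high∣ c)) 2≤p p≈e
          ... | inj₂ (ts , refl , refl , ts>0) = ih [] (e ∷ qs) (ω ++ γ)
            (config (Low-replace (ω ++ ts) p≈e (subst Low eq (low c))) (high c)
              (≤-trans (≤-trans (+-monoˡ-≤ (length qs) (<⇒≤ 2≤p)) (≤-reflexive (sym (length-++ (ω ++ ts)))))
                       (subst (λ us → length us ≤ l) eq (∣low∣ c)))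
              (∣high∣ c))
            shorter
            where
            shorter : suc (length qs) < length (ts ++ qs) ⊎ (suc (length qs) ≤ length (ts ++ qs) × 0 < length ω)
            shorter with length ω ≟ 0
            ... | yes ω≡0 = inj₁ (subst (suc (length qs) <_) (sym (length-++ ts))
              (+-monoˡ-≤ (length qs) (subst (2 ≤_) (trans (length-++ ω) (cong (_+ length ts) ω≡0)) 2≤p)))
            ... | no  ω≢0 = inj₂ (subst (length qs <_) (sym (length-++ ts)) (m<n+m (length qs) ts>0) , n≢0⇒n>0 ω≢0)

        -- The lists U and V arising from the exchange have total length at most 2 l, and a list that is
        -- neither low nor high has length at least 2 + N > l.  So whenever one of them is too long or high,
        -- the other one is short enough to take part in a smaller configuration.
        exchange : ∀ ω α₁ α₂ γ₁ γ₂ → Config ω (α₁ ++ α₂) (γ₁ ++ γ₂) → Descends ω (α₁ ++ α₂) → l ≤ suc N →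
                   0 < length α₁ → 0 < length α₂ → ¬ ΣX α₁ ≈ ΣX γ₁
        exchange ω α₁ α₂ γ₁ γ₂ c ih l≤1+N α₁>0 α₂>0 α₁≈γ₁ = go (length V ≤? l)
          where
          U V : List (Fin ℓ)
          U = ω ++ γ₁ ++ α₂
          V = ω ++ α₁ ++ γ₂

          classU : ΣX U ≈ x
          classU = ≈-trans (subst₂ _≈_ (sym (trans (Σ-++ X ω _) (cong (ΣX ω +_) (Σ-++ X γ₁ α₂))))
            (sym (trans (Σ-++ X ω _) (cong (ΣX ω +_) (Σ-++ X α₁ α₂))))
            (≈-+ {ΣX ω} (≈-reflexive refl) (≈-+ (≈-sym α₁≈γ₁) (≈-reflexive refl)))) (Low.class (low c))

          classV : ΣX V ≈ x
          classV = ≈-trans (subst₂ _≈_ (sym (trans (Σ-++ X ω _) (cong (ΣX ω +_) (Σ-++ X α₁ γ₂))))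
            (sym (trans (Σ-++ X ω _) (cong (ΣX ω +_) (Σ-++ X γ₁ γ₂))))
            (≈-+ {ΣX ω} (≈-reflexive refl) (≈-+ α₁≈γ₁ (≈-reflexive refl)))) (High.class (high c))

          length₃ : ∀ (ps qs ss : List (Fin ℓ)) → length (ps ++ qs ++ ss) ≡ length ps + (length qs + length ss)
          length₃ ps qs ss = trans (length-++ ps) (cong (length ps +_) (length-++ qs))

          ∣U∣+∣V∣ : length U + length V ≡ length (ω ++ α₁ ++ α₂) + l
          ∣U∣+∣V∣ = begin
            length U + length V
              ≡⟨ cong₂ _+_ (length₃ ω γ₁ α₂) (length₃ ω α₁ γ₂) ⟩
            (length ω + (length γ₁ + length α₂)) + (length ω + (length α₁ + length γ₂))
              ≡⟨ eq (length ω) (length α₁) (length α₂) (length γ₁) (length γ₂) ⟩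
            (length ω + (length α₁ + length α₂)) + (length ω + (length γ₁ + length γ₂))
              ≡⟨ cong₂ _+_ (length₃ ω α₁ α₂) (length₃ ω γ₁ γ₂) ⟨
            length (ω ++ α₁ ++ α₂) + length (ω ++ γ₁ ++ γ₂)
              ≡⟨ cong (length (ω ++ α₁ ++ α₂) +_) (∣high∣ c) ⟩
            length (ω ++ α₁ ++ α₂) + l ∎
            where
            open ≡-Reasoning
            eq : ∀ w a a′ g g′ → (w + (g + a′)) + (w + (a + g′)) ≡ (w + (a + a′)) + (w + (g + g′))
            eq = solve-∀

          swap : ∀ ps qs ss → ps ++ qs ++ ss ↭ (ps ++ ss) ++ qs
          swap ps qs ss = ↭-trans (↭.++⁺ˡ ps (↭.++-comm qs ss)) (↭-reflexive (sym (++-assoc ps ss qs)))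

          α₁<α : length α₁ < length (α₁ ++ α₂)
          α₁<α = subst (length α₁ <_) (sym (length-++ α₁)) (m<m+n (length α₁) α₂>0)

          -- In this and the next two cases `U` or `V` replaces one list of the pair. Besides `ω`,
          -- the new pair shares `γ₁`, `γ₂` or `α₂` respectively, so only a proper part of
          -- `α₁ ++ α₂` remains unshared in the low list.
          U-low : Low U → length U ≤ l → ⊥
          U-low lo U≤l = ih (ω ++ γ₁) α₂ γ₂
            (config (subst Low (sym (++-assoc ω γ₁ α₂)) lo) (subst High (sym (++-assoc ω γ₁ γ₂)) (high c))
                    (subst (λ us → length us ≤ l) (sym (++-assoc ω γ₁ α₂)) U≤l)
                    (trans (cong length (++-assoc ω γ₁ γ₂)) (∣high∣ c)))
            (inj₁ (subst (length α₂ <_) (sym (length-++ α₁)) (m<n+m (length α₂) α₁>0)))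

          V-low : Low V → length V ≤ l → ⊥
          V-low lo V≤l = ih (ω ++ γ₂) α₁ γ₁
            (config (Low-↭ (swap ω α₁ γ₂) lo) (High-↭ (swap ω γ₁ γ₂) (high c))
                    (subst (_≤ l) (↭.↭-length (swap ω α₁ γ₂)) V≤l)
                    (trans (sym (↭.↭-length (swap ω γ₁ γ₂))) (∣high∣ c)))
            (inj₁ α₁<α)

          U-high : High U → length U ≡ l → ⊥
          U-high hi U≡l = ih (ω ++ α₂) α₁ γ₁
            (config (Low-↭ (swap ω α₁ α₂) (low c)) (High-↭ (swap ω γ₁ α₂) hi)
                    (subst (_≤ l) (↭.↭-length (swap ω α₁ α₂)) (∣low∣ c))
                    (trans (sym (↭.↭-length (swap ω γ₁ α₂))) U≡l))
            (inj₁ α₁<α)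

          too-long : ∀ {n} → 2 + N ≤ n → n ≤ l → ⊥
          too-long p q = <⇒≱ (≤-trans p q) l≤1+N

          ∣U∣+∣V∣≤ : length U + length V ≤ l + l
          ∣U∣+∣V∣≤ = ≤-trans (≤-reflexive ∣U∣+∣V∣) (+-monoˡ-≤ l (∣low∣ c))

          U≤l-cases : length U ≤ l → Low U ⊎ High U ⊎ 2 + N ≤ length U → ⊥
          U≤l-cases U≤l (inj₁ lo)          = U-low lo U≤l
          U≤l-cases U≤l (inj₂ (inj₁ hi))   = U-high hi (≤-antisym U≤l (minHigh hi))
          U≤l-cases U≤l (inj₂ (inj₂ long)) = too-long long U≤l

          V≤l-cases : length V ≤ l → Low V ⊎ High V ⊎ 2 + N ≤ length V → ⊥
          V≤l-cases V≤l (inj₁ lo)          = V-low lo V≤l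
          V≤l-cases V≤l (inj₂ (inj₁ hi))   = U≤l-cases (+-cancelʳ-≤ l _ _
            (≤-trans (+-monoʳ-≤ (length U) (minHigh hi)) ∣U∣+∣V∣≤)) (classify U classU)
          V≤l-cases V≤l (inj₂ (inj₂ long)) = too-long long V≤l

          go : Dec (length V ≤ l) → ⊥
          go (yes V≤l) = V≤l-cases V≤l (classify V classV)
          go (no V≰l)  = U≤l-cases (+-cancelʳ-≤ l _ _
            (≤-trans (+-monoʳ-≤ (length U) (<⇒≤ (≰⇒> V≰l))) ∣U∣+∣V∣≤)) (classify U classU)

        -- If `ps` ends inside `ω`, the rest of `ps′` is a zero-sum block of the high list. If `ps`
        -- is the whole low list, its sum is congruent to that of the whole high list, so `qs′` is
        -- such a block. Otherwise `exchange` applies.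
        crossing : ∀ {ω α γ} → Config ω α γ → Descends ω α → l ≤ suc N →
                   ∀ ps {qs} ps′ {qs′} → ω ++ α ≡ ps ++ qs → ω ++ γ ≡ ps′ ++ qs′ →
                   length ω < length ps′ → 0 < length qs′ → ¬ ΣX ps ≈ ΣX ps′
        crossing {ω} {α} {γ} c ih l≤ ps {qs} ps′ {qs′} eq eq′ ω<ps′ qs′>0 ps≈ps′ with ++-split ω ps′ eq′
        ... | inj₁ (ts , refl , _) = <⇒≱ ω<ps′ (subst (length ps′ ≤_) (sym (length-++ ps′)) (m≤m+n _ _))
        ... | inj₂ (γ₁ , refl , refl , γ₁>0) with ++-split ω ps eq
        ...   | inj₁ (ts , refl , _) = high-zero-sum-free ps (ts ++ γ₁) (subst High assoc (high c))
          (trans (cong length (sym assoc)) (∣high∣ c))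
          (≤-trans γ₁>0 (subst (length γ₁ ≤_) (sym (length-++ ts)) (m≤n+m _ _)))
          (≈-sym (≈-cancelˡ (ΣX ps) (subst₂ _≈_ (sym (+-identityʳ (ΣX ps)))
            (trans (cong ΣX (++-assoc ps ts γ₁)) (Σ-++ X ps (ts ++ γ₁))) ps≈ps′)))
          where
          assoc : (ps ++ ts) ++ γ₁ ++ qs′ ≡ ps ++ (ts ++ γ₁) ++ qs′
          assoc = trans (++-assoc ps ts (γ₁ ++ qs′)) (cong (ps ++_) (sym (++-assoc ts γ₁ qs′)))
        ...   | inj₂ (α₁ , refl , refl , α₁>0) with qs
        ...     | q ∷ qs₁ = exchange ω α₁ (q ∷ qs₁) γ₁ qs′ c ih l≤ α₁>0 z<s
          (≈-cancelˡ (ΣX ω) (subst₂ _≈_ (Σ-++ X ω α₁) (Σ-++ X ω γ₁) ps≈ps′))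
        ...     | [] = high-zero-sum-free (ω ++ γ₁) qs′ (subst High assoc (high c))
          (trans (cong length (sym assoc)) (∣high∣ c)) qs′>0
          (≈-cancelˡ (ΣX (ω ++ γ₁)) (≈-trans
            (subst (_≈ x) (trans (cong ΣX (sym (++-assoc ω γ₁ qs′))) (Σ-++ X (ω ++ γ₁) qs′)) (High.class (high c)))
            (≈-trans (≈-sym (Low.class (low c)))
              (≈-trans (subst (_≈ ΣX (ω ++ γ₁)) (cong (λ us → ΣX (ω ++ us)) (sym (++-identityʳ α₁))) ps≈ps′)
                       (≈-reflexive (sym (+-identityʳ _)))))))
          where
          assoc : ω ++ γ₁ ++ qs′ ≡ (ω ++ γ₁) ++ qs′ ++ []
          assoc = trans (sym (++-assoc ω γ₁ qs′)) (cong ((ω ++ γ₁) ++_) (sym (++-identityʳ qs′)))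

        -- Prefix sums and the pigeonhole bounds on lengths.

        segment : ∀ {i j} (us : List (Fin ℓ)) → i < j → j ≤ length us →
                  ∃ λ qs → us ≡ take i us ++ qs ++ drop j us × take j us ≡ take i us ++ qs × 0 < length qs
        segment {i} {j} us i<j j≤ = qs , eq₁ , eq₂ , qs>0
          where
          qs = take (j ∸ i) (drop i us)
          i+d≡j = m+[n∸m]≡n (<⇒≤ i<j)
          eq₂ : take j us ≡ take i us ++ qs
          eq₂ = trans (cong (λ t → take t us) (sym i+d≡j)) (take-+ i (j ∸ i) us)
          eq₁ : us ≡ take i us ++ qs ++ drop j us
          eq₁ = trans (sym (take++drop≡id j us)) (trans (cong (_++ drop j us) eq₂) (++-assoc (take i us) qs (drop j us)))
          qs>0 : 0 < length qs
          qs>0 = subst (0 <_) (sym (trans (length-take (j ∸ i) (drop i us)) (m≤n⇒m⊓n≡m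
            (subst (j ∸ i ≤_) (sym (length-drop i us)) (∸-monoˡ-≤ i j≤))))) (m<n⇒0<n∸m i<j)

        prefixes-distinct : ∀ us → (∀ ps qs {ss} → us ≡ ps ++ qs ++ ss → 0 < length qs → ¬ ΣX qs ≈ 0) →
                            ∀ i j → i < j → j ≤ length us → ¬ ΣX (take i us) ≈ ΣX (take j us)
        prefixes-distinct us zero-sum-free i j i<j j≤ eq with segment us i<j j≤
        ... | qs , eq₁ , eq₂ , qs>0 = zero-sum-free (take i us) qs eq₁ qs>0 (≈-sym (≈-cancelˡ (ΣX (take i us))
          (subst₂ _≈_ (sym (+-identityʳ _)) (trans (cong ΣX eq₂) (Σ-++ X (take i us) qs)) eq)))

        high-zero-sum-free-≡ : ∀ {us} → High us → length us ≡ l →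
                           ∀ ps qs {ss} → us ≡ ps ++ qs ++ ss → 0 < length qs → ¬ ΣX qs ≈ 0
        high-zero-sum-free-≡ hi len ps qs refl = high-zero-sum-free ps qs hi len

        high-prefix : ∀ {us} → High us → length us ≡ l → ∀ i → 2 ≤ i → i ≤ l →
                      ¬ ΣX (take i us) ≈ 0 × (∀ e → ¬ ΣX (take i us) ≈ X e)
        high-prefix {us} hi len i 2≤i i≤l =
          high-zero-sum-free-≡ hi len [] (take i us) {drop i us} (sym (take++drop≡id i us)) (≤-trans z<s 2≤p) ,
          λ e → high-irreducible (take i us) {drop i us} (subst High (sym (take++drop≡id i us)) hi)
            (trans (cong length (take++drop≡id i us)) len) 2≤p
          where
          2≤p : 2 ≤ length (take i us)
          2≤p = subst (2 ≤_) (sym (length-prefix (subst (i ≤_) (sym len) i≤l))) 2≤i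

        low-prefix : ∀ {ω α γ} → Config ω α γ → Descends ω α → ∀ i → 2 ≤ i → i ≤ length (ω ++ α) →
                     ¬ ΣX (take i (ω ++ α)) ≈ 0 × (∀ e → ¬ ΣX (take i (ω ++ α)) ≈ X e)
        low-prefix {ω} {α} c ih i 2≤i i≤ =
          low-zero-sum-free c ih [] (take i (ω ++ α)) {drop i (ω ++ α)} (sym (take++drop≡id i (ω ++ α))) (≤-trans z<s 2≤p) ,
          λ e → low-irreducible c ih (take i (ω ++ α)) {drop i (ω ++ α)} (sym (take++drop≡id i (ω ++ α))) 2≤p
          where
          2≤p : 2 ≤ length (take i (ω ++ α))
          2≤p = subst (2 ≤_) (sym (length-prefix {us = ω ++ α} i≤)) 2≤i

        open Residues S

        -- The prefixes of lengths 2 to `l` give `l ∸ 1` distinct residues outside `A`, of which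
        -- there are at most `N`. One-term prefixes lie in `A` and are left out.
        High⇒l≤1+N : ∀ {us} → High us → length us ≡ l → l ≤ suc N
        High⇒l≤1+N {us} hi len = ≤-trans (m≤n+m∸n l 1) (s≤s (+-cancelˡ-≤ (suc ℓ) _ _
          (≤-trans (≤-trans (≤-reflexive (sym (length-residues f 0 g (l ∸ 1))))
            (Unique-bounded (residues-unique f 0 g (l ∸ 1) (λ _ ()) (λ _ _ _ ()) avoids distinct (λ _ _ ()))
              (residues-bounded f 0 g (l ∸ 1)))) b≤1+ℓ+N)))
          where
          f g : ℕ → ℕ
          f _ = 0
          g i = ΣX (take (2 + i) us)
          avoids : Avoids g (l ∸ 1)
          avoids i i< = high-prefix hi len (2 + i) (s≤s (s≤s z≤n)) (i<n∸m⇒m+i<n 1 i<)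
          distinct : Distinct g (l ∸ 1)
          distinct i j i<j j< = prefixes-distinct us (high-zero-sum-free-≡ hi len) (2 + i) (2 + j) (s≤s (s≤s i<j))
            (subst (2 + j ≤_) (sym len) (i<n∸m⇒m+i<n 1 j<))

        module _ {ω α γ} (c : Config ω α γ) (ih : Descends ω α) where

          k : ℕ
          k = length (ω ++ α)

          l≤1+N : l ≤ suc N
          l≤1+N = High⇒l≤1+N (high c) (∣high∣ c)

          module _ (h : ℕ) (1≤h : 1 ≤ h) (ω≤h : length ω ≤ h) where

            -- `f` runs over the prefixes of the low list of lengths 2 to `k`, and `g` over those of
            -- the high list of lengths `suc h` to `l ∸ 1`. The latter have at least two terms,
            -- extend beyond `ω` and are proper, as `crossing` requires.
            f g : ℕ → ℕ
            f i = ΣX (take (2 + i) (ω ++ α))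
            g j = ΣX (take (suc h + j) (ω ++ γ))

            config-residues-unique : Unique (residues f (k ∸ 1) g (l ∸ suc h))
            config-residues-unique = residues-unique f (k ∸ 1) g (l ∸ suc h)
              (λ i i< → low-prefix c ih (2 + i) (s≤s (s≤s z≤n)) (i<n∸m⇒m+i<n 1 i<))
              (λ i j i<j j< → prefixes-distinct (ω ++ α) (low-zero-sum-free c ih) (2 + i) (2 + j)
                (s≤s (s≤s i<j)) (i<n∸m⇒m+i<n 1 j<))
              (λ j j< → high-prefix (high c) (∣high∣ c) (suc h + j) (s≤s (≤-trans 1≤h (m≤m+n h j)))
                (<⇒≤ (i<n∸m⇒m+i<n (suc h) j<)))
              (λ i j i<j j< → prefixes-distinct (ω ++ γ) (high-zero-sum-free-≡ (high c) (∣high∣ c)) (suc h + i) (suc h + j)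
                (+-monoʳ-< (suc h) i<j) (subst (suc h + j ≤_) (sym (∣high∣ c)) (<⇒≤ (i<n∸m⇒m+i<n (suc h) j<))))
              (λ i j i< j< → crossing c ih l≤1+N (take (2 + i) (ω ++ α)) {drop (2 + i) (ω ++ α)}
                (take (suc h + j) (ω ++ γ)) {drop (suc h + j) (ω ++ γ)}
                (sym (take++drop≡id (2 + i) (ω ++ α))) (sym (take++drop≡id (suc h + j) (ω ++ γ)))
                (subst (length ω <_) (sym (length-prefix {us = ω ++ γ}
                    (subst (suc h + j ≤_) (sym (∣high∣ c)) (<⇒≤ (i<n∸m⇒m+i<n (suc h) j<)))))
                  (s≤s (≤-trans ω≤h (m≤m+n h j))))
                (subst (0 <_) (sym (length-drop (suc h + j) (ω ++ γ)))
                  (m<n⇒0<n∸m (subst (suc h + j <_) (sym (∣high∣ c)) (i<n∸m⇒m+i<n (suc h) j<)))))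

            config-bound : k + l ≤ suc (suc h) + N
            config-bound = begin
              -- Only `n ≤ m + (n ∸ m)` is used, so truncation of the differences does no harm.
              k + l                                     ≤⟨ +-mono-≤ (m≤n+m∸n k 1) (m≤n+m∸n l (suc h)) ⟩
              (1 + (k ∸ 1)) + (suc h + (l ∸ suc h))     ≡⟨ eq (k ∸ 1) h (l ∸ suc h) ⟩
              suc (suc h) + ((k ∸ 1) + (l ∸ suc h))     ≤⟨ +-monoʳ-≤ (suc (suc h)) (+-cancelˡ-≤ (suc ℓ) _ _
                (≤-trans (≤-trans (≤-reflexive (sym (length-residues f (k ∸ 1) g (l ∸ suc h))))
                  (Unique-bounded config-residues-unique (residues-bounded f (k ∸ 1) g (l ∸ suc h)))) b≤1+ℓ+N)) ⟩
              suc (suc h) + N                           ∎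
              where
              open ≤-Reasoning
              eq : ∀ p h q → (1 + p) + (suc h + q) ≡ suc (suc h) + (p + q)
              eq = solve-∀

          -- The low list has `ΣY` at least `y + b`, while `ω`, as part of the high list,
          -- contributes at most `y`.
          α>0 : 0 < length α
          α>0 = nonempty α (≤-trans (>-nonZero⁻¹ b) (+-cancelˡ-≤ y b (ΣY α) (begin
            y + b                 ≤⟨ Low⇒ (low c) ⟩
            ΣY (ω ++ α)           ≡⟨ Σ-++ Y ω α ⟩
            ΣY ω + ΣY α           ≤⟨ +-monoˡ-≤ (ΣY α) (m≤m+n (ΣY ω) (ΣY γ)) ⟩
            ΣY ω + ΣY γ + ΣY α    ≡⟨ cong (_+ ΣY α) (Σ-++ Y ω γ) ⟨
            ΣY (ω ++ γ) + ΣY α    ≤⟨ +-monoˡ-≤ (ΣY α) (High.bound (high c)) ⟩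
            y + ΣY α              ∎)))
            where
            open ≤-Reasoning
            nonempty : ∀ us → 0 < ΣY us → 0 < length us
            nonempty (_ ∷ _) _ = z<s

          -- All coordinates of both lists add up to `(k + l) * b`. `ΣY` of the low list and `ΣX` of
          -- the high list give at least `(2 + N) * b`; the other two sums contain both coordinates
          -- of `ω`, that is `length ω * b`, and the positive `ΣX α`.
          config-lower : suc (suc (length ω)) + N < k + l
          config-lower = *-cancelʳ-< b _ _ (begin-strict
            (suc (suc (length ω)) + N) * b                           ≡⟨ eq₁ (length ω) N b ⟩
            length ω * b + (N * b + (b + b))                         ≡⟨ cong (λ t → length ω * b + (t + (b + b))) x+y≡N*b ⟨
            length ω * b + (x + y + (b + b))                         ≡⟨ eq₂ (length ω * b) x y b ⟩
            length ω * b + ((y + b) + (x + b))                       <⟨ m<n+m _ (≤-trans α>0 (Σ-≥length X X>0 α)) ⟩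
            ΣX α + (length ω * b + ((y + b) + (x + b)))
              ≤⟨ +-monoʳ-≤ (ΣX α) (+-monoʳ-≤ (length ω * b) (+-mono-≤ (Low⇒ (low c)) (High⇒ (high c)))) ⟩
            ΣX α + (length ω * b + (ΣY (ω ++ α) + ΣX (ω ++ γ)))      ≤⟨ m≤m+n _ (ΣY γ) ⟩
            ΣX α + (length ω * b + (ΣY (ω ++ α) + ΣX (ω ++ γ))) + ΣY γ
              ≡⟨ cong (λ t → ΣX α + (t + (ΣY (ω ++ α) + ΣX (ω ++ γ))) + ΣY γ) (ΣX+ΣY ω) ⟨
            ΣX α + (ΣX ω + ΣY ω + (ΣY (ω ++ α) + ΣX (ω ++ γ))) + ΣY γ
              ≡⟨ eq₃ (ΣX α) (ΣX ω) (ΣY ω) (ΣY (ω ++ α)) (ΣX (ω ++ γ)) (ΣY γ) ⟩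
            ((ΣX ω + ΣX α) + ΣY (ω ++ α)) + (ΣX (ω ++ γ) + (ΣY ω + ΣY γ))
              ≡⟨ cong₂ (λ p q → (p + ΣY (ω ++ α)) + (ΣX (ω ++ γ) + q)) (Σ-++ X ω α) (Σ-++ Y ω γ) ⟨
            (ΣX (ω ++ α) + ΣY (ω ++ α)) + (ΣX (ω ++ γ) + ΣY (ω ++ γ))
              ≡⟨ cong₂ _+_ (ΣX+ΣY (ω ++ α)) (trans (ΣX+ΣY (ω ++ γ)) (cong (_* b) (∣high∣ c))) ⟩
            k * b + l * b                                            ≡⟨ *-distribʳ-+ b k l ⟨
            (k + l) * b                                              ∎)
            where
            open ≤-Reasoning
            eq₁ : ∀ h N b → (suc (suc h) + N) * b ≡ h * b + (N * b + (b + b))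
            eq₁ = solve-∀
            eq₂ : ∀ h x y b → h + (x + y + (b + b)) ≡ h + ((y + b) + (x + b))
            eq₂ = solve-∀
            eq₃ : ∀ a w w′ p q g → a + (w + w′ + (p + q)) + g ≡ ((w + a) + p) + (q + (w′ + g))
            eq₃ = solve-∀

          ω≡0 : length ω ≡ 0
          ω≡0 with length ω ≟ 0
          ... | yes eq = eq
          -- Choosing `h` as the length of `ω` makes the upper bound fall just short of the lower
          -- one.
          ... | no  ω≢0 = contradiction (config-bound (length ω) (n≢0⇒n>0 ω≢0) ≤-refl) (<⇒≱ config-lower)

          k+l≡3+N : k + l ≡ 3 + N
          -- With `ω` empty, `h` must still be 1 to skip the one-term prefix. The upper bound is
          -- weaker by one and meets the lower bound.
          k+l≡3+N = ≤-antisym (config-bound 1 ≤-refl (subst (_≤ 1) (sym ω≡0) z≤n))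
            (subst (λ t → suc (suc (suc t)) + N ≤ k + l) ω≡0 config-lower)


        -- The extremal case, where all bounds are equalities.

        module Tight {α γ} (c : Config [] α γ) (ih : Descends [] α) where
          open ≤-Reasoning

          α+γ : length α + length γ ≡ 3 + N
          α+γ = trans (cong (length α +_) (∣high∣ c)) (k+l≡3+N c ih)

          2≤α′ : 2 ≤ length α
          2≤α′ = +-cancelʳ-≤ (suc N) 2 (length α) (begin
            2 + suc N                 ≡⟨ k+l≡3+N c ih ⟨
            length α + l              ≤⟨ +-monoʳ-≤ (length α) (l≤1+N c ih) ⟩
            length α + suc N          ∎)

          α≤γ′ : length α ≤ length γ
          α≤γ′ = subst (length α ≤_) (sym (∣high∣ c)) (∣low∣ c)

          total : (ΣX α + ΣY γ) + (ΣY α + ΣX γ) ≡ b + ((y + b) + (x + b))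
          total = begin-equality
            (ΣX α + ΣY γ) + (ΣY α + ΣX γ)       ≡⟨ eq₁ (ΣX α) (ΣY γ) (ΣY α) (ΣX γ) ⟩
            (ΣX α + ΣY α) + (ΣX γ + ΣY γ)       ≡⟨ cong₂ _+_ (ΣX+ΣY α) (ΣX+ΣY γ) ⟩
            length α * b + length γ * b         ≡⟨ *-distribʳ-+ b (length α) (length γ) ⟨
            (length α + length γ) * b           ≡⟨ cong (_* b) α+γ ⟩
            (3 + N) * b                         ≡⟨ eq₂ b (N * b) ⟩
            b + (N * b + (b + b))               ≡⟨ cong (λ t → b + (t + (b + b))) x+y≡N*b ⟨
            b + (x + y + (b + b))               ≡⟨ eq₃ x y b ⟩
            b + ((y + b) + (x + b))             ∎
            where
            eq₁ : ∀ p q r s → (p + q) + (r + s) ≡ (p + r) + (s + q)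
            eq₁ = solve-∀
            eq₂ : ∀ b n → b + (b + (b + n)) ≡ b + (n + (b + b))
            eq₂ = solve-∀
            eq₃ : ∀ x y b → b + (x + y + (b + b)) ≡ b + ((y + b) + (x + b))
            eq₃ = solve-∀

          -- By `total`, the lower bounds on `ΣY α` and `ΣX γ` leave at most `b` for this sum. It is
          -- positive and congruent to `x + y`, hence to 0, so it is also at least `b`.
          sums′ : ΣX α + ΣY γ ≡ b
          sums′ = ≤-antisym
            (+-cancelʳ-≤ (ΣY α + ΣX γ) _ _ (≤-trans (≤-reflexive total)
              (+-monoʳ-≤ b (+-mono-≤ (Low⇒ (low c)) (High⇒ (high c))))))
            (≈∧<⇒+b≤ (≈-sym (≈-trans (≈-+ (Low.class (low c)) (ΣY≈y {γ} (High.class (high c)))) x+y≈0))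
              (≤-trans (≤-trans (s≤s z≤n) 2≤α′) (≤-trans (Σ-≥length X X>0 α) (m≤m+n _ _))))

          outer : ΣY α + ΣX γ ≡ (y + b) + (x + b)
          outer = +-cancelˡ-≡ b _ _ (trans (cong (_+ (ΣY α + ΣX γ)) (sym sums′)) total)

          ΣX<b : ∀ i → ΣX (take i α) < b
          ΣX<b i = begin-strict
            ΣX (take i α)    ≤⟨ Σ-take-≤ X i α ⟩
            ΣX α             <⟨ m<m+n (ΣX α) (≤-trans (≤-trans (s≤s z≤n) (≤-trans 2≤α′ α≤γ′)) (Σ-≥length Y Y>0 γ)) ⟩
            ΣX α + ΣY γ      ≡⟨ sums′ ⟩
            b                ∎

          ΣY<b : ∀ j → ΣY (take j γ) < b
          ΣY<b j = begin-strict
            ΣY (take j γ)    ≤⟨ Σ-take-≤ Y j γ ⟩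
            ΣY γ             <⟨ m<n+m (ΣY γ) (≤-trans (≤-trans (s≤s z≤n) 2≤α′) (Σ-≥length X X>0 α)) ⟩
            ΣX α + ΣY γ      ≡⟨ sums′ ⟩
            b                ∎

          F G : ℕ → ℕ
          F i = ΣX (take (2 + i) α)
          G j = ΣX (take (2 + j) γ)

          -- The list is free of repetitions and, since `k + l = 3 + N`, has at least `b` entries;
          -- so every residue occurs.
          exhaustive : ∀ {u} → u < b → u ∈ residues F (length α ∸ 1) G (l ∸ 2)
          exhaustive = Unique-exhaustive (config-residues-unique c ih 1 ≤-refl z≤n)
              (residues-bounded F (length α ∸ 1) G (l ∸ 2)) (begin
                b                                                   ≤⟨ b≤1+ℓ+N ⟩
                suc (ℓ + N)                                         ≤⟨ s≤s (+-monoʳ-≤ ℓ (+-cancelˡ-≤ 3 N _ (begin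
                  3 + N                                                ≡⟨ k+l≡3+N c ih ⟨
                  length α + l                                         ≤⟨ +-mono-≤ (m≤n+m∸n (length α) 1) (m≤n+m∸n l 2) ⟩
                  (1 + (length α ∸ 1)) + (2 + (l ∸ 2))                 ≡⟨ eq (length α ∸ 1) (l ∸ 2) ⟩
                  3 + ((length α ∸ 1) + (l ∸ 2))                       ∎))) ⟩
                suc (ℓ + ((length α ∸ 1) + (l ∸ 2)))                ≡⟨ length-residues F (length α ∸ 1) G (l ∸ 2) ⟨
                length (residues F (length α ∸ 1) G (l ∸ 2))        ∎)
              where
              eq : ∀ p q → (1 + p) + (2 + q) ≡ 3 + (p + q)
              eq = solve-∀

          complete′ : Complete α γ
          complete′ u v u+v≡b u>0 v>0 =
            [ in-A , [ (λ u∈ → in-F (∈-applyUpTo⁻ (λ i → F i % b) u∈))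
                     , (λ u∈ → in-G (∈-applyUpTo⁻ (λ j → G j % b) u∈)) ]′
                     ∘ ∈-++⁻ (applyUpTo (λ i → F i % b) (length α ∸ 1)) ]′
            (∈-++⁻ (0 ∷ tabulate X) (exhaustive u<b))
            where
            Cases : Set
            Cases = (∃ λ e → X e ≡ u) ⊎
              (∃ λ i → 2 ≤ i × i ≤ length α × ΣX (take i α) ≡ u) ⊎
              (∃ λ j → 2 ≤ j × j ≤ length γ × ΣY (take j γ) ≡ v)

            u<b : u < b
            u<b = subst (u <_) u+v≡b (m<m+n u v>0)

            v<b : v < b
            v<b = subst (v <_) u+v≡b (m<n+m v u>0)

            in-A : u ∈ 0 ∷ tabulate X → Cases
            in-A (here u≡0)  = contradiction (sym u≡0) (<⇒≢ u>0)
            in-A (there u∈X) = inj₁ (proj₁ (∈-tabulate⁻ u∈X) , sym (proj₂ (∈-tabulate⁻ u∈X)))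

            in-F : (∃ λ i → i < length α ∸ 1 × u ≡ F i % b) → Cases
            in-F (i , i< , eq) = inj₂ (inj₁ (2 + i , s≤s (s≤s z≤n) , i<n∸m⇒m+i<n 1 i< ,
              sym (trans eq (m<n⇒m%n≡m (ΣX<b (2 + i))))))

            -- `ΣX` of a prefix of `γ` may exceed `b`. Its `ΣY` does not, and neither does `v`, so
            -- the congruence of these complements is an equality.
            in-G : (∃ λ j → j < l ∸ 2 × u ≡ G j % b) → Cases
            in-G (j , j< , eq) = inj₂ (inj₂ (2 + j , s≤s (s≤s z≤n) ,
              subst (2 + j ≤_) (sym (∣high∣ c)) (<⇒≤ (i<n∸m⇒m+i<n 2 j<)) ,
              ≤-antisym (≈∧<b⇒≤ w≈v (ΣY<b (2 + j))) (≈∧<b⇒≤ (≈-sym w≈v) v<b)))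
              where
              w≈v : ΣY (take (2 + j) γ) ≈ v
              w≈v = ≈-complement (≈-trans (ΣX+ΣY≈0 (take (2 + j) γ)) (≈-sym (b≈0 u+v≡b)))
                (≈-sym (≈-trans (≈-reflexive eq) (%-≈ (G j))))

        terminal : ∀ {α γ} → Config [] α γ → Descends [] α → Terminal α γ
        terminal {α} {γ} c ih = record
          { low      = low c
          ; high     = high c
          ; 2≤α      = 2≤α′
          ; α≤γ      = α≤γ′
          ; sums     = sums′
          ; ΣYα≤y+b  = +-cancelʳ-≤ (x + b) _ _ (≤-trans (+-monoʳ-≤ (ΣY α) (High⇒ (high c))) (≤-reflexive outer))
          ; ΣXγ≤x+b  = +-cancelˡ-≤ (y + b) _ _ (≤-trans (+-monoˡ-≤ (ΣX γ) (Low⇒ (low c))) (≤-reflexive outer))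
          -- With no shared part, rearranged lists again form a configuration, and the induction
          -- hypothesis depends on `α` only through its length.
          ; complete = λ {α′} {γ′} p q → Tight.complete′
              (config {[]} {α′} {γ′} (Low-↭ (↭-sym p) (low c)) (High-↭ (↭-sym q) (high c))
                (subst (_≤ l) (sym (↭.↭-length p)) (∣low∣ c)) (trans (↭.↭-length q) (∣high∣ c)))
              (λ ω₁ α₁ γ₁ c₁ d → ih ω₁ α₁ γ₁ c₁
                (subst (λ n → length α₁ < n ⊎ (length α₁ ≤ n × length ω₁ < 0)) (↭.↭-length p) d))
          ; low-irreducible  = λ i e 2≤i i≤ eq → proj₂ (low-prefix c ih i 2≤i i≤) e (≈-reflexive eq)
          ; high-irreducible = λ j e 2≤j j≤ eq → proj₂ (high-prefix (high c) (∣high∣ c) j 2≤j (subst (j ≤_) (∣high∣ c) j≤)) e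
              (≈-complement (≈-trans (≈-reflexive (+-comm (ΣY (take j γ)) _)) (≈-trans (ΣX+ΣY≈0 (take j γ))
                 (≈-sym (b≈0 (trans (+-comm (Y e) (X e)) (X+Y≡b e))))))
                (≈-reflexive eq))
          }
          where open Tight c ih

        module _ (no-terminal : ∀ {α γ} → ¬ Terminal α γ) where

          step : ∀ ω {α γ} → Config ω α γ → Descends ω α → ⊥
          step (u ∷ ω) c ih = contradiction (ω≡0 c ih) λ ()
          step []      c ih = no-terminal (terminal c ih)

          descend : ∀ n h ω α γ → length α < n → length ω < h → ¬ Config ω α γ
          descend (suc n) (suc h) ω α γ (s≤s α≤n) (s≤s ω≤h) c = step ω c λ ω′ α′ γ′ c′ →
            -- When `α` shrinks, the shared part may have become longer, so its bound is set afresh.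
            [ (λ α′<α → descend n (suc (length ω′)) ω′ α′ γ′ (≤-trans α′<α α≤n) ≤-refl c′)
            , (λ d → descend (suc n) h ω′ α′ γ′ (s≤s (≤-trans (proj₁ d) α≤n)) (≤-trans (proj₂ d) ω≤h) c′) ]′

  -- Exchange of `A` and `b - A`, and the exceptional families.

  mirror : ∀ {ℓ b} → System ℓ b → System ℓ b
  mirror S = record
    { X           = Y
    ; Y           = X
    ; X+Y≡b       = λ e → trans (+-comm (Y e) (X e)) (X+Y≡b e)
    ; X>0         = Y>0
    ; Y>0         = X>0
    ; X-injective = λ {e} {f} eq → X-injective (+-cancelʳ-≡ (Y e) _ _
        (trans (X+Y≡b e) (trans (sym (X+Y≡b f)) (cong (X f +_) (sym eq)))))
    }
    where open System S

  -- Families (i) and (ii), in terms of the interior values f of a set with endpoints 0 and b.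
  Punctured Gapped : ∀ {ℓ} → ℕ → (Fin ℓ → ℕ) → Set
  Punctured b f = ∃ λ r → 2 ≤ r × r + 2 ≤ b × (∀ v → 0 < v → v < b → (∃ λ e → f e ≡ v) ⇔ v ≢ r)
  Gapped    b f = ∃ λ a → 2 ≤ a × a + 2 ≤ b × (∀ v → 0 < v → v < b → (∃ λ e → f e ≡ v) ⇔ (v ≡ 1 ⊎ a < v))

  Regular : ∀ {ℓ} → ℕ → (Fin ℓ → ℕ) → Set
  Regular b f = ¬ Punctured b f × ¬ Gapped b f

  Σ-take-ones : ∀ {a} {A : Set a} (f : A → ℕ) {us} → All (λ u → f u ≡ 1) us →
                ∀ {i} → i ≤ length us → Σ f (take i us) ≡ i
  Σ-take-ones f ones       {zero}  _        = refl
  Σ-take-ones f (p ∷ ones) {suc i} (s≤s i≤) = cong₂ _+_ p (Σ-take-ones f ones i≤)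

  Σ-ones : ∀ {a} {A : Set a} (f : A → ℕ) {us} → All (λ u → f u ≡ 1) us → Σ f us ≡ length us
  Σ-ones f {us} ones = trans (cong (Σ f) (sym (take-all (length us) us ≤-refl))) (Σ-take-ones f ones ≤-refl)

  -- A shortest list cannot be picked without deciding `P`, but for the goal `⊥` induction on the
  -- length serves the same purpose.
  minimal-elim : ∀ {a p} {A : Set a} (P : List A → Set p) →
                 (∀ us → P us → (∀ {vs} → P vs → length us ≤ length vs) → ⊥) → ∀ us → ¬ P us
  minimal-elim P step us = go (suc (length us)) us ≤-refl
    where
    go : ∀ n us → length us < n → ¬ P us
    go (suc n) us (s≤s us≤n) p = step us p λ {vs} q → ≮⇒≥ λ vs<us → go n vs (≤-trans vs<us us≤n) q

  0<∧≢1⇒2≤ : ∀ {v} → 0 < v → v ≢ 1 → 2 ≤ v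
  0<∧≢1⇒2≤ {suc zero}    _ v≢1 = contradiction refl v≢1
  0<∧≢1⇒2≤ {suc (suc v)} _ _   = s≤s (s≤s z≤n)

  module _ {ℓ b : ℕ} .{{_ : NonZero b}} (S : System ℓ b) (N x y : ℕ) (x+y≡N*b : x + y ≡ N * b)
           (b≤1+ℓ+N : b ≤ suc (ℓ + N)) where
    open System S
    open Congruence b
    private
      module C = Core S N x y x+y≡N*b b≤1+ℓ+N
      module M = Core (mirror S) N y x (trans (+-comm y x) x+y≡N*b) b≤1+ℓ+N
    open C using (ΣX; ΣY)

    High⇒mirror-Low : ∀ {us} → C.High us → M.Low us
    High⇒mirror-Low {us} h = C.ΣY≈y {us} (C.High.class h) M.& C.High.bound h

    Low⇒mirror-High : ∀ {us} → C.Low us → M.High us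
    Low⇒mirror-High {us} h = C.ΣY≈y {us} (C.Low.class h) M.& C.Low.bound h

    mirror-High⇒Low : ∀ {us} → M.High us → C.Low us
    mirror-High⇒Low {us} h = M.ΣY≈y {us} (M.High.class h) C.& M.High.bound h

    module _ (uncovered : ∀ us → ΣX us ≈ x → ΣX us ≤ x → ΣY us ≤ y → ⊥) where
      private
        module U = C.Uncovered uncovered
        module V = M.Uncovered (λ us c hi lo → uncovered us (M.ΣY≈y {us} c) lo hi)

      Complete-mirror : ∀ {α γ} → U.Complete α γ → V.Complete γ α
      Complete-mirror complete u v u+v≡b u>0 v>0 with complete v u (trans (+-comm v u) u+v≡b) v>0 u>0
      ... | inj₁ (e , refl)  = inj₁ (e , +-cancelʳ-≡ (X e) _ _ (trans (trans (+-comm (Y e) (X e)) (X+Y≡b e)) (sym u+v≡b)))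
      ... | inj₂ (inj₁ p)    = inj₂ (inj₂ p)
      ... | inj₂ (inj₂ p)    = inj₂ (inj₁ p)

      -- A terminal pair forces a family.

      module _ {α γ : List (Fin ℓ)} (T : U.Terminal α γ) where
        open U.Terminal T
        open ≤-Reasoning

        α-ones : 3 ≤ length α → All (λ e → X e ≡ 1) α
        α-ones 3≤α = U.all-ones (λ p → complete p ↭-refl) sums low ΣYα≤y+b 3≤α

        γ-ones : 3 ≤ length γ → All (λ e → Y e ≡ 1) γ
        γ-ones 3≤γ = V.all-ones (λ q → Complete-mirror (complete ↭-refl q))
          (trans (+-comm (ΣY γ) (ΣX α)) sums) (High⇒mirror-Low high) ΣXγ≤x+b 3≤γ

        2≤ΣXα : 2 ≤ ΣX α
        2≤ΣXα = ≤-trans 2≤α (Σ-≥length X X>0 α)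

        2≤γ : 2 ≤ length γ
        2≤γ = ≤-trans 2≤α α≤γ

        whole-α : length α ≤ 2 → ∀ {i} → 2 ≤ i → ΣX (take i α) ≡ ΣX α
        whole-α α≤2 2≤i = cong ΣX (take-all _ α (≤-trans α≤2 2≤i))

        whole-γ : length γ ≤ 2 → ∀ {j} → 2 ≤ j → ΣY (take j γ) ≡ ΣY γ
        whole-γ γ≤2 2≤j = cong ΣY (take-all _ γ (≤-trans γ≤2 2≤j))

        X⇒Y : ∀ {e u v} → u + v ≡ b → X e ≡ u → Y e ≡ v
        X⇒Y {e} u+v≡b refl = +-cancelˡ-≡ (X e) _ _ (trans (X+Y≡b e) (sym u+v≡b))

        cofactor : ∀ {v} → v < b → v + (b ∸ v) ≡ b
        cofactor v<b = m+[n∸m]≡n (<⇒≤ v<b)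

        -- Both lists have two terms, so only the full sums `ΣX α` and `ΣY γ` count as prefix sums.
        -- They add up to `b` and so describe the same single missing value.
        punctured : length γ ≤ 2 → Punctured b X
        punctured γ≤2 = ΣX α , 2≤ΣXα ,
          subst (ΣX α + 2 ≤_) sums (+-monoʳ-≤ (ΣX α) (≤-trans 2≤γ (Σ-≥length Y Y>0 γ))) ,
          λ v v>0 v<b → mk⇔
            (λ { (e , Xe≡v) v≡r → low-irreducible 2 e ≤-refl 2≤α (trans (whole-α α≤2 ≤-refl) (trans (sym v≡r) (sym Xe≡v))) })
            (λ v≢r → [ (λ p → p)
                     , [ (λ { (i , 2≤i , _ , eq) → contradiction (trans (sym eq) (whole-α α≤2 2≤i)) v≢r })
                       , (λ { (j , 2≤j , _ , eq) → contradiction (+-cancelʳ-≡ (ΣY γ) _ _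
                             (trans (cong (v +_) (trans (sym (whole-γ γ≤2 2≤j)) eq)) (trans (cofactor v<b) (sym sums)))) v≢r }) ]′ ]′
                     (complete ↭-refl ↭-refl v (b ∸ v) (cofactor v<b) v>0 (m<n⇒0<n∸m v<b)))
          where
          α≤2 : length α ≤ 2
          α≤2 = ≤-trans α≤γ γ≤2

        -- The `Y`-sums of prefixes of `γ` are 2 up to `length γ`, and the only prefix sum of `α` is
        -- complementary to `length γ`. So exactly these values are missing from `b - A`.
        gapped-mirror : length α ≤ 2 → 3 ≤ length γ → Gapped b Y
        gapped-mirror α≤2 3≤γ = length γ , 2≤γ ,
          subst₂ _≤_ (+-comm 2 (length γ)) ΣXα+γ (+-monoˡ-≤ (length γ) 2≤ΣXα) ,
          λ w w>0 w<b → mk⇔ (λ p → to w w>0 p (w ≟ 1) (length γ <? w))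
            (λ p → from w (b ∸ w) (trans (+-comm (b ∸ w) w) (cofactor w<b)) w>0 (m<n⇒0<n∸m w<b) p)
          where
          ones = γ-ones 3≤γ

          ΣXα+γ : ΣX α + length γ ≡ b
          ΣXα+γ = trans (cong (ΣX α +_) (sym (Σ-ones Y ones))) sums

          to : ∀ w → 0 < w → (∃ λ e → Y e ≡ w) → Dec (w ≡ 1) → Dec (length γ < w) → w ≡ 1 ⊎ length γ < w
          to w w>0 (e , Ye≡w) (yes w≡1) _         = inj₁ w≡1
          to w w>0 (e , Ye≡w) (no _)    (yes γ<w) = inj₂ γ<w
          to w w>0 (e , Ye≡w) (no w≢1)  (no γ≮w)  = ⊥-elim (high-irreducible w e (0<∧≢1⇒2≤ w>0 w≢1) (≮⇒≥ γ≮w)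
            (trans (Σ-take-ones Y ones (≮⇒≥ γ≮w)) (sym Ye≡w)))

          outside : ∀ {w} → w ≡ 1 ⊎ length γ < w → 2 ≤ w → w ≤ length γ → ⊥
          outside (inj₁ refl) 2≤1 _   = <-irrefl refl 2≤1
          outside (inj₂ γ<w)  _   w≤γ = <⇒≱ γ<w w≤γ

          w≡γ : ∀ {u w i} → u + w ≡ b → 2 ≤ i → ΣX (take i α) ≡ u → w ≡ length γ
          w≡γ {u} u+w≡b 2≤i eq = +-cancelˡ-≡ u _ _
            (trans u+w≡b (trans (sym ΣXα+γ) (cong (_+ length γ) (trans (sym (whole-α α≤2 2≤i)) eq))))

          from : ∀ w u → u + w ≡ b → 0 < w → 0 < u → w ≡ 1 ⊎ length γ < w → ∃ λ e → Y e ≡ w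
          from w u u+w≡b w>0 u>0 p =
            [ (λ { (e , Xe≡u) → e , X⇒Y u+w≡b Xe≡u })
            , [ (λ { (i , 2≤i , _ , eq) → ⊥-elim (outside p
                  (subst (2 ≤_) (sym (w≡γ u+w≡b 2≤i eq)) 2≤γ) (≤-reflexive (w≡γ u+w≡b 2≤i eq))) })
              , (λ { (j , 2≤j , j≤γ , eq) → ⊥-elim (outside p
                  (subst (2 ≤_) (j≡w j≤γ eq) 2≤j) (subst (_≤ length γ) (j≡w j≤γ eq) j≤γ)) }) ]′ ]′
            (complete ↭-refl ↭-refl u w u+w≡b u>0 w>0)
            where
            j≡w : ∀ {j} → j ≤ length γ → ΣY (take j γ) ≡ w → j ≡ w
            j≡w j≤γ eq = trans (sym (Σ-take-ones Y ones j≤γ)) eq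

        -- The prefixes of `α` exclude the values from 2 to `length α`, and those of `γ` exclude the
        -- values from `b - length γ = length α` to `b - 2`. Only 1 and `b - 1` are left in the
        -- interior, which is family (ii) with `a = b - 2`.
        gapped : 3 ≤ length α → Gapped b X
        gapped 3≤α = b ∸ 2 , 2≤b∸2 , ≤-reflexive (m∸n+n≡m (≤-trans (s≤s (s≤s z≤n)) 6≤b)) ,
          λ v v>0 v<b → mk⇔ (λ p → to v (b ∸ v) (cofactor v<b) v>0 (m<n⇒0<n∸m v<b) p
                                      (v ≟ 1) (b ∸ v ≟ 1) (v ≤? length α))
                            (from v (b ∸ v) (cofactor v<b) v>0 (m<n⇒0<n∸m v<b))
          where
          3≤γ : 3 ≤ length γ
          3≤γ = ≤-trans 3≤α α≤γ

          α+γ≡b : length α + length γ ≡ b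
          α+γ≡b = trans (cong₂ _+_ (sym (Σ-ones X (α-ones 3≤α))) (sym (Σ-ones Y (γ-ones 3≤γ)))) sums

          6≤b : 6 ≤ b
          6≤b = subst (6 ≤_) α+γ≡b (+-mono-≤ 3≤α 3≤γ)

          2≤b∸2 : 2 ≤ b ∸ 2
          2≤b∸2 = ≤-trans (s≤s (s≤s z≤n)) (∸-monoˡ-≤ 2 6≤b)

          w≤γ : ∀ {v w} → v + w ≡ b → length α < v → w ≤ length γ
          w≤γ {v} {w} v+w≡b α<v = +-cancelˡ-≤ (length α) _ _ (begin
            length α + w           ≤⟨ +-monoˡ-≤ w (<⇒≤ α<v) ⟩
            v + w                  ≡⟨ v+w≡b ⟩
            b                      ≡⟨ α+γ≡b ⟨
            length α + length γ    ∎)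

          to : ∀ v w → v + w ≡ b → 0 < v → 0 < w → (∃ λ e → X e ≡ v) →
               Dec (v ≡ 1) → Dec (w ≡ 1) → Dec (v ≤ length α) → v ≡ 1 ⊎ b ∸ 2 < v
          to v w v+w≡b v>0 w>0 _ (yes v≡1) _ _ = inj₁ v≡1
          to v w v+w≡b v>0 w>0 _ (no _) (yes w≡1) _ = inj₂ (≤-reflexive (trans
            (cong (λ t → suc (t ∸ 2)) (trans (sym v+w≡b) (trans (cong (v +_) w≡1) (+-comm v 1)))) (m+[n∸m]≡n v>0)))
          to v w v+w≡b v>0 w>0 (e , Xe≡v) (no v≢1) (no _) (yes v≤α) =
            ⊥-elim (low-irreducible v e (0<∧≢1⇒2≤ v>0 v≢1) v≤α (trans (Σ-take-ones X (α-ones 3≤α) v≤α) (sym Xe≡v)))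
          to v w v+w≡b v>0 w>0 (e , Xe≡v) (no _) (no w≢1) (no v≰α) =
            ⊥-elim (high-irreducible w e (0<∧≢1⇒2≤ w>0 w≢1) (w≤γ v+w≡b (≰⇒> v≰α))
              (trans (Σ-take-ones Y (γ-ones 3≤γ) (w≤γ v+w≡b (≰⇒> v≰α))) (sym (X⇒Y v+w≡b Xe≡v))))

          w≡1 : ∀ {v w} → v + w ≡ b → 0 < w → b ∸ 2 < v → w ≡ 1
          w≡1 {v} {w} v+w≡b w>0 b-2<v = ≤-antisym (s≤s⁻¹ (+-cancelˡ-< v w 2 (begin-strict
            v + w            ≡⟨ v+w≡b ⟩
            b                ≤⟨ m≤n+m∸n b 2 ⟩
            2 + (b ∸ 2)      <⟨ +-monoʳ-< 2 b-2<v ⟩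
            2 + v            ≡⟨ +-comm 2 v ⟩
            v + 2            ∎))) w>0

          not-α : ∀ {v w i} → v + w ≡ b → 0 < w → 2 ≤ i → i ≤ length α → i ≡ v → v ≡ 1 ⊎ b ∸ 2 < v → ⊥
          not-α v+w≡b w>0 2≤i i≤α refl (inj₁ i≡1)   = <⇒≢ 2≤i (sym i≡1)
          not-α {w = w} v+w≡b w>0 2≤i i≤α refl (inj₂ b-2<i) =
            <⇒≢ (≤-trans (s≤s (s≤s z≤n)) (≤-trans 3≤γ γ≤w)) (sym (w≡1 v+w≡b w>0 b-2<i))
            where
            γ≤w : length γ ≤ w
            γ≤w = +-cancelˡ-≤ (length α) _ _ (≤-trans (≤-reflexive (trans α+γ≡b (sym v+w≡b))) (+-monoˡ-≤ w i≤α))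

          not-γ : ∀ {v w j} → v + w ≡ b → 0 < w → 2 ≤ j → j ≤ length γ → j ≡ w → v ≡ 1 ⊎ b ∸ 2 < v → ⊥
          not-γ {v} v+w≡b w>0 2≤j j≤γ refl (inj₁ v≡1) =
            <⇒≢ (≤-trans (s≤s (s≤s z≤n)) (≤-trans 3≤α α≤v)) (sym v≡1)
            where
            α≤v : length α ≤ v
            α≤v = +-cancelʳ-≤ (length γ) _ _ (≤-trans (≤-reflexive (trans α+γ≡b (sym v+w≡b))) (+-monoʳ-≤ v j≤γ))
          not-γ v+w≡b w>0 2≤j j≤γ refl (inj₂ b-2<v) = <⇒≢ 2≤j (sym (w≡1 v+w≡b w>0 b-2<v))

          from : ∀ v w → v + w ≡ b → 0 < v → 0 < w → v ≡ 1 ⊎ b ∸ 2 < v → ∃ λ e → X e ≡ v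
          from v w v+w≡b v>0 w>0 p =
            [ (λ q → q)
            , [ (λ { (i , 2≤i , i≤α , eq) → ⊥-elim (not-α v+w≡b w>0 2≤i i≤α
                  (trans (sym (Σ-take-ones X (α-ones 3≤α) i≤α)) eq) p) })
              , (λ { (j , 2≤j , j≤γ , eq) → ⊥-elim (not-γ v+w≡b w>0 2≤j j≤γ
                  (trans (sym (Σ-take-ones Y (γ-ones 3≤γ) j≤γ)) eq) p) }) ]′ ]′
            (complete ↭-refl ↭-refl v w v+w≡b v>0 w>0)

      no-terminal : Regular b X → Regular b Y → ∀ {α γ} → ¬ U.Terminal α γ
      no-terminal (¬pX , ¬gX) (_ , ¬gY) {α} {γ} T = cases (length α ≤? 2) (length γ ≤? 2)
        where
        cases : Dec (length α ≤ 2) → Dec (length γ ≤ 2) → ⊥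
        cases (no α≰2)  _         = ¬gX (gapped T (≰⇒> α≰2))
        cases (yes _)   (yes γ≤2) = ¬pX (punctured T γ≤2)
        cases (yes α≤2) (no γ≰2)  = ¬gY (gapped-mirror T α≤2 (≰⇒> γ≰2))

      Low-shorter : Regular b X → Regular b Y → ∀ {α γ} → C.Low α → C.High γ →
                    (∀ {us} → C.High us → length γ ≤ length us) → length α ≤ length γ → ⊥
      Low-shorter rX rY {α} {γ} lo hi minHigh α≤γ =
        U.Descent.descend (length γ) minHigh (no-terminal rX rY) (suc (length α)) 1 [] α γ ≤-refl ≤-refl
          (U.Descent.config lo hi α≤γ refl)

  module _ {ℓ b : ℕ} .{{_ : NonZero b}} (S : System ℓ b) (N x y : ℕ) (x+y≡N*b : x + y ≡ N * b)
           (b≤1+ℓ+N : b ≤ suc (ℓ + N)) where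
    open System S
    open Congruence b
    open Core S N x y x+y≡N*b b≤1+ℓ+N
    private
      y+x≡N*b : y + x ≡ N * b
      y+x≡N*b = trans (+-comm y x) x+y≡N*b
      module M = Core (mirror S) N y x y+x≡N*b b≤1+ℓ+N

    -- The descent is run on a shortest low and a shortest high list, in the mirrored system if the
    -- low one is longer.
    Low∧High⇒covered : Regular b X → Regular b Y → ∀ α γ → Low α → High γ →
                       ¬ (∀ us → ΣX us ≈ x → ΣX us ≤ x → ΣY us ≤ y → ⊥)
    Low∧High⇒covered rX rY α γ lo hi uncovered = minimal-elim High
      (λ γ hi minHigh → minimal-elim Low
        (λ α lo minLow → by-length α γ lo hi minLow minHigh (length α ≤? length γ)) α lo) γ hi
      where
      by-length : ∀ α γ → Low α → High γ → (∀ {us} → Low us → length α ≤ length us) →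
                  (∀ {us} → High us → length γ ≤ length us) → Dec (length α ≤ length γ) → ⊥
      by-length α γ lo hi minLow minHigh (yes α≤γ) =
        Low-shorter S N x y x+y≡N*b b≤1+ℓ+N uncovered rX rY lo hi minHigh α≤γ
      by-length α γ lo hi minLow minHigh (no α≰γ) =
        Low-shorter (mirror S) N y x y+x≡N*b b≤1+ℓ+N
          (λ us c up lo → uncovered us (M.ΣY≈y {us} c) lo up) rY rX
          (High⇒mirror-Low S N x y x+y≡N*b b≤1+ℓ+N hi) (Low⇒mirror-High S N x y x+y≡N*b b≤1+ℓ+N lo)
          (λ h → minLow (mirror-High⇒Low S N x y x+y≡N*b b≤1+ℓ+N h)) (<⇒≤ (≰⇒> α≰γ))

open Combinatorics

open import Data.Empty using (⊥)
open import Data.Fin.Base as Fin using (Fin; fromℕ; inject₁)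
import Data.Fin.Properties as Fin
open import Data.Fin.Relation.Unary.Top using (view; ‵fromℕ; ‵inject₁)
open import Data.Integer.Base using (ℤ; +_; -[1+_]; 0ℤ; 1ℤ; ∣_∣; _+_; _*_; _-_; _⊔_; _≤_; _<_; +≤+)
import Data.Integer.Properties as ℤ
open import Data.Integer.Tactic.RingSolver using (solve-∀)
open import Data.List.Base using ([]; _∷_; length)
open import Data.Nat.Base as ℕ using (ℕ; zero; suc; z≤n; s≤s)
import Data.Nat.Properties as ℕ
open import Data.Nat.Tactic.RingSolver using () renaming (solve-∀ to ℕ-solve-∀)
open import Data.Product.Base using (_×_; _,_; ∃; ∃₂; proj₁; proj₂)
open import Data.Sum.Base using (_⊎_; inj₁; inj₂; [_,_]′)
open import Data.Vec.Functional as Vector using (Vector; head; tail)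
open import Function.Bundles using (_⇔_; mk⇔; module Equivalence)
open import Relation.Binary.Core using (_Preserves_⟶_)
open import Relation.Binary.Definitions using (tri<; tri≈; tri>)
open import Relation.Binary.PropositionalEquality using (_≡_; refl; sym; trans; cong; cong₂; subst; subst₂; module ≡-Reasoning)
open import Relation.Nullary using (¬_; Dec; contradiction)
open import Relation.Nullary.Decidable using (map′; decidable-stable)
open import Relation.Unary using (_≐_; _∪_; _∖_)

open Equivalence using (to; from)

-- Translation between sumsets of integers and lists of interior elements.

infix 4 _SpannedBy_,_
_SpannedBy_,_ : ∀ {ℓ} → ℤSet → (Fin ℓ → ℕ) → ℕ → Set
A SpannedBy f , B = ∀ z → A z ⇔ (z ≡ 0ℤ ⊎ z ≡ + B ⊎ ∃ λ e → z ≡ + f e)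

module _ (A : ℤSet) where

  ·-cons : ∀ {n x} z → A z → (n · A) x → (suc n · A) (z + x)
  ·-cons z z∈A (xs , xs∈A , eq) = z Vector.∷ xs , (λ { Fin.zero → z∈A ; (Fin.suc i) → xs∈A i }) , cong (λ t → z + t) eq

  ·-reflect : ∀ b {n x} → (n · A) x → (n · (b ⊖ A)) (b * + n - x)
  ·-reflect b {n} (xs , xs∈A , refl) = (λ i → b - xs i) , (λ i → xs i , xs∈A i , refl) , sum-reflect n xs
    where
    eq : ∀ b z n s → (b - z) + (b * n - s) ≡ b * (1ℤ + n) - (z + s)
    eq = solve-∀
    sum-reflect : ∀ n (xs : Vector ℤ n) → sumᵛ (λ i → b - xs i) ≡ b * + n - sumᵛ xs
    sum-reflect zero    xs = sym (trans (ℤ.+-identityʳ (b * 0ℤ)) (ℤ.*-zeroʳ b))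
    sum-reflect (suc n) xs = trans (cong (λ t → b - head xs + t) (sum-reflect n (tail xs)))
      (eq b (head xs) (+ n) (sumᵛ (tail xs)))

module _ {ℓ B} {A : ℤSet} {f : Fin ℓ → ℕ} (spans : A SpannedBy f , B) where
  open Congruence B

  -- Summands 0 and `B` are discarded: this preserves the class modulo `B` and does not increase the
  -- sum.
  ·⇒list : ∀ n {x} → (n · A) x → ∃₂ λ us m → x ≡ + m × Σ f us ≈ m × Σ f us ℕ.≤ m
  ·⇒list zero    (xs , _ , refl) = [] , 0 , refl , ≈-reflexive refl , z≤n
  ·⇒list (suc n) (xs , xs∈A , refl) 
    with ·⇒list n (tail xs , (λ i → xs∈A (Fin.suc i)) , refl) | to (spans (head xs)) (xs∈A Fin.zero)
  ... | us , m , eq , us≈m , us≤m | inj₁ z≡0 = us , m , cong₂ _+_ z≡0 eq , us≈m , us≤m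
  ... | us , m , eq , us≈m , us≤m | inj₂ (inj₁ z≡B) =
    us , B ℕ.+ m , cong₂ _+_ z≡B eq , ≈-+ {0} (≈-sym (b≈0 refl)) us≈m , ℕ.≤-trans us≤m (ℕ.m≤n+m m B)
  ... | us , m , eq , us≈m , us≤m | inj₂ (inj₂ (e , z≡fe)) =
    e ∷ us , f e ℕ.+ m , cong₂ _+_ z≡fe eq , ≈-+ {f e} (≈-reflexive refl) us≈m , ℕ.+-monoʳ-≤ (f e) us≤m

  list⇒· : ∀ us s t → ((length us ℕ.+ (s ℕ.+ t)) · A) (+ (Σ f us ℕ.+ s ℕ.* B))
  list⇒· [] zero zero    = (λ ()) , (λ ()) , refl
  list⇒· [] zero (suc t) = ·-cons A 0ℤ (from (spans 0ℤ) (inj₁ refl)) (list⇒· [] zero t)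
  list⇒· [] (suc s) t    = ·-cons A (+ B) (from (spans (+ B)) (inj₂ (inj₁ refl))) (list⇒· [] s t)
  list⇒· (e ∷ us) s t    = subst (_ · A) (cong +_ (sym (ℕ.+-assoc (f e) _ _)))
    (·-cons A (+ f e) (from (spans (+ f e)) (inj₂ (inj₂ (e , refl)))) (list⇒· us s t))

  module _ (f>0 : ∀ e → 0 ℕ.< f e) (f<B : ∀ e → f e ℕ.< B) where

    private
      ≤B-2 : ∀ {r} → r ℕ.+ 2 ℕ.≤ B → + r ≤ + B - + 2
      ≤B-2 {r} r+2≤B = subst (+ r ≤_) (sym (trans (ℤ.m-n≡m⊖n B 2) (ℤ.⊖-≥ (ℕ.≤-trans (ℕ.m≤n+m 2 r) r+2≤B))))
        (+≤+ (ℕ.m+n≤o⇒m≤o∸n r r+2≤B))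

      endpoint-cases : ∀ {v} → v ℕ.≤ B → v ≡ 0 ⊎ v ≡ B ⊎ (0 ℕ.< v × v ℕ.< B)
      endpoint-cases {zero}  _ = inj₁ refl
      endpoint-cases {suc v} v≤B = [ (λ v<B → inj₂ (inj₂ (ℕ.z<s , v<B))) , (λ eq → inj₂ (inj₁ eq)) ]′ (ℕ.m≤n⇒m<n∨m≡n v≤B)

    Punctured⇒FamilyI : Punctured B f → FamilyI (+ B) A
    Punctured⇒FamilyI (r , 2≤r , r+2≤B , values) = + r , +≤+ 2≤r , ≤B-2 r+2≤B , ⊆ , λ {z} → ⊇ {z}
      where
      r<B : r ℕ.< B
      r<B = ℕ.≤-trans (ℕ.≤-trans (ℕ.≤-reflexive (ℕ.+-comm 1 r)) (ℕ.+-monoʳ-≤ r (s≤s z≤n))) r+2≤B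

      ⊆ : ∀ {z} → A z → (0ℤ ≤ z × z ≤ + B) × ¬ + r ≡ z
      ⊆ {z} z∈A with to (spans z) z∈A
      ... | inj₁ refl                = (ℤ.≤-refl , +≤+ z≤n) , λ r≡0 → ℕ.<⇒≢ (ℕ.≤-trans (s≤s z≤n) 2≤r) (sym (ℤ.+-injective r≡0))
      ... | inj₂ (inj₁ refl)         = (+≤+ z≤n , ℤ.≤-refl) , λ r≡B → ℕ.<⇒≢ r<B (ℤ.+-injective r≡B)
      ... | inj₂ (inj₂ (e , refl))   = (+≤+ z≤n , +≤+ (ℕ.<⇒≤ (f<B e))) ,
        λ r≡fe → to (values (f e) (f>0 e) (f<B e)) (e , refl) (sym (ℤ.+-injective r≡fe))

      ⊇ : ∀ {z} → (0ℤ ≤ z × z ≤ + B) × ¬ + r ≡ z → A z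
      ⊇ {+ v} ((_ , +≤+ v≤B) , r≢v) with endpoint-cases v≤B
      ... | inj₁ refl                = from (spans (+ v)) (inj₁ refl)
      ... | inj₂ (inj₁ refl)         = from (spans (+ v)) (inj₂ (inj₁ refl))
      ... | inj₂ (inj₂ (v>0 , v<B)) with from (values v v>0 v<B) (λ v≡r → r≢v (cong +_ (sym v≡r)))
      ...   | e , fe≡v = from (spans (+ v)) (inj₂ (inj₂ (e , cong +_ (sym fe≡v))))
      ⊇ { -[1+ _ ] } ((() , _) , _)

    Gapped⇒FamilyII : Gapped B f → FamilyII (+ B) A
    Gapped⇒FamilyII (a , 2≤a , a+2≤B , values) = + a , +≤+ 2≤a , ≤B-2 a+2≤B , ⊆ , ⊇
      where
      a+1≤B : a ℕ.+ 1 ℕ.≤ B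
      a+1≤B = ℕ.≤-trans (ℕ.+-monoʳ-≤ a (s≤s z≤n)) a+2≤B

      ⊆ : ∀ {z} → A z → 0ℤ ≡ z ⊎ 1ℤ ≡ z ⊎ (+ a + 1ℤ ≤ z × z ≤ + B)
      ⊆ {z} z∈A with to (spans z) z∈A
      ... | inj₁ refl                = inj₁ refl
      ... | inj₂ (inj₁ refl)         = inj₂ (inj₂ (+≤+ a+1≤B , ℤ.≤-refl))
      ... | inj₂ (inj₂ (e , refl)) with to (values (f e) (f>0 e) (f<B e)) (e , refl)
      ...   | inj₁ fe≡1 = inj₂ (inj₁ (cong +_ (sym fe≡1)))
      ...   | inj₂ a<fe = inj₂ (inj₂ (+≤+ (ℕ.≤-trans (ℕ.≤-reflexive (ℕ.+-comm a 1)) a<fe) , +≤+ (ℕ.<⇒≤ (f<B e))))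

      value : ∀ {v} → 0 ℕ.< v → v ℕ.< B → v ≡ 1 ⊎ a ℕ.< v → A (+ v)
      value {v} v>0 v<B p with from (values v v>0 v<B) p
      ... | e , fe≡v = from (spans (+ v)) (inj₂ (inj₂ (e , cong +_ (sym fe≡v))))

      ⊇ : ∀ {z} → 0ℤ ≡ z ⊎ 1ℤ ≡ z ⊎ (+ a + 1ℤ ≤ z × z ≤ + B) → A z
      ⊇ (inj₁ refl)        = from (spans 0ℤ) (inj₁ refl)
      ⊇ (inj₂ (inj₁ refl)) = value ℕ.z<s (ℕ.≤-trans (s≤s (ℕ.≤-trans (s≤s z≤n) 2≤a))
        (ℕ.≤-trans (ℕ.≤-reflexive (ℕ.+-comm 1 a)) a+1≤B)) (inj₁ refl)
      ⊇ (inj₂ (inj₂ (+≤+ {n = v} a+1≤v , +≤+ v≤B))) with endpoint-cases v≤B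
      ... | inj₁ refl              = from (spans 0ℤ) (inj₁ refl)
      ... | inj₂ (inj₁ refl)       = from (spans (+ B)) (inj₂ (inj₁ refl))
      ... | inj₂ (inj₂ (v>0 , v<B)) = value v>0 v<B (inj₂ (ℕ.≤-trans (ℕ.≤-reflexive (ℕ.+-comm 1 a)) a+1≤v))

-- The first summand is searched among finitely many entries. Decidability later removes a double
-- negation.
·image? : ∀ {k} (a : Vector ℤ k) N x → Dec ((N · image a) x)
·image? a zero    x = map′ (λ x≡0 → (λ ()) , (λ ()) , sym x≡0) (λ { (_ , _ , eq) → sym eq }) (x ℤ.≟ 0ℤ)
·image? a (suc N) x = map′
  (λ { (i , p) → subst (suc N · image a) (cancel x (a i)) (·-cons (image a) (a i) (i , refl) p) })
  (λ { (xs , xs∈A , refl) → proj₁ (xs∈A Fin.zero) , tail xs , (λ i → xs∈A (Fin.suc i)) ,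
       sym (trans (cong (λ t → sumᵛ xs - t) (proj₂ (xs∈A Fin.zero))) (cancel′ (head xs) (sumᵛ (tail xs)))) })
  (Fin.any? λ i → ·image? a N (x - a i))
  where
  cancel : ∀ x z → z + (x - z) ≡ x
  cancel = solve-∀
  cancel′ : ∀ z s → z + s - z ≡ s
  cancel′ = solve-∀

module _ {ℓ B : ℕ} .{{_ : ℕ.NonZero B}} (S : System ℓ B) {A A′ : ℤSet}
         (spans : A SpannedBy System.X S , B) (spans′ : A′ SpannedBy System.Y S , B)
         (regular : Regular B (System.X S)) (regular′ : Regular B (System.Y S)) where
  open System S
  open Congruence B

  -- Not being in `𝓔` yields membership in the unbounded union `𝓟` only up to double negation, and
  -- the conclusion inherits this.
  ∉𝓔⇒¬¬∈· : ∀ N m m′ → m ℕ.+ m′ ≡ N ℕ.* B → B ℕ.≤ suc (ℓ ℕ.+ N) →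
             ¬ 𝓔 A (+ m) → ¬ 𝓔 A′ (+ m′) → ¬ ¬ (N · A) (+ m)
  ∉𝓔⇒¬¬∈· N m m′ m+m′ B≤ m∉𝓔 m′∉𝓔 m∉NA =
    low m spans m∉𝓔 λ { (α , α≈ , α≤) → low m′ spans′ m′∉𝓔 λ { (γ , γ≈ , γ≤) →
    Low∧High⇒covered S N m m′ m+m′ B≤ regular regular′ α γ (α≈ C.& α≤) (M.ΣY≈y {γ} γ≈ C.& γ≤) uncovered } }
    where
    module C = Core S N m m′ m+m′ B≤
    module M = Core (mirror S) N m′ m (trans (ℕ.+-comm m′ m) m+m′) B≤

    low : ∀ m {f : Fin ℓ → ℕ} {A} → A SpannedBy f , B → ¬ 𝓔 A (+ m) → ¬ ¬ (∃ λ us → Σ f us ≈ m × Σ f us ℕ.≤ m)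
    -- 0 is never in `𝓔`; the empty list represents it.
    low zero    spans _   k = k ([] , ≈-reflexive refl , z≤n)
    low (suc m) spans ∉𝓔 k = ∉𝓔 (+≤+ (s≤s z≤n) , λ { (n , _ , m∈nA) → found (·⇒list spans n m∈nA) })
      where
      found : (∃₂ λ us m₁ → + suc m ≡ + m₁ × Σ _ us ≈ m₁ × Σ _ us ℕ.≤ m₁) → ⊥
      found (us , _ , refl , us≈ , us≤) = k (us , us≈ , us≤)

    uncovered : ∀ us → C.ΣX us ≈ m → C.ΣX us ℕ.≤ m → C.ΣY us ℕ.≤ m′ → ⊥
    uncovered us us≈ X≤ Y≤ = pad (≈⇒≡+* us≈ X≤) (≈⇒≡+* (C.ΣY≈y {us} us≈) Y≤)
      where
      regroup : ∀ k B s t → k ℕ.* B ℕ.+ (s ℕ.* B ℕ.+ t ℕ.* B) ≡ (k ℕ.+ (s ℕ.+ t)) ℕ.* B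
      regroup = ℕ-solve-∀
      interchange : ∀ p q r s → (p ℕ.+ q) ℕ.+ (r ℕ.+ s) ≡ (p ℕ.+ r) ℕ.+ (q ℕ.+ s)
      interchange = ℕ-solve-∀
      pad : (∃ λ s → m ≡ C.ΣX us ℕ.+ s ℕ.* B) → (∃ λ t → m′ ≡ C.ΣY us ℕ.+ t ℕ.* B) → ⊥
      -- The deficit in `ΣX` is filled with `s` copies of `B`, the one in `ΣY` with `t` zeros, which
      -- are copies of `B` after reflection. Adding the coordinates shows that there are `N`
      -- summands.
      pad (s , m≡) (t , m′≡) = m∉NA (subst₂ (λ n z → (n · A) (+ z)) count (sym m≡) (list⇒· spans us s t))
        where
        count : length us ℕ.+ (s ℕ.+ t) ≡ N
        count = ℕ.*-cancelʳ-≡ _ N B (begin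
          (length us ℕ.+ (s ℕ.+ t)) ℕ.* B                              ≡⟨ regroup (length us) B s t ⟨
          length us ℕ.* B ℕ.+ (s ℕ.* B ℕ.+ t ℕ.* B)                    ≡⟨ cong (ℕ._+ (s ℕ.* B ℕ.+ t ℕ.* B)) (C.ΣX+ΣY us) ⟨
          (C.ΣX us ℕ.+ C.ΣY us) ℕ.+ (s ℕ.* B ℕ.+ t ℕ.* B)              ≡⟨ interchange (C.ΣX us) (C.ΣY us) (s ℕ.* B) (t ℕ.* B) ⟩
          (C.ΣX us ℕ.+ s ℕ.* B) ℕ.+ (C.ΣY us ℕ.+ t ℕ.* B)              ≡⟨ cong₂ ℕ._+_ m≡ m′≡ ⟨
          m ℕ.+ m′                                                     ≡⟨ m+m′ ⟩
          N ℕ.* B                                                      ∎)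
          where open ≡-Reasoning

-- The system attached to an increasing vector.

module Interior {ℓ : ℕ} (a : Vector ℤ (suc (suc ℓ))) (a-mono : a Preserves Fin._<_ ⟶ _<_)
                (a₀≡0 : head a ≡ 0ℤ) where

  top : Fin (suc (suc ℓ))
  top = fromℕ (suc ℓ)

  B : ℕ
  B = ∣ a top ∣

  a≥0 : ∀ i → 0ℤ ≤ a i
  a≥0 Fin.zero    = ℤ.≤-reflexive (sym a₀≡0)
  a≥0 (Fin.suc i) = ℤ.<⇒≤ (subst (_< a (Fin.suc i)) a₀≡0 (a-mono ℕ.z<s))

  a≡ : ∀ i → a i ≡ + ∣ a i ∣
  a≡ i = sym (ℤ.0≤i⇒+∣i∣≡i (a≥0 i))

  ∣a∣-mono : ∀ {i j} → i Fin.< j → ∣ a i ∣ ℕ.< ∣ a j ∣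
  ∣a∣-mono {i} {j} i<j = ℤ.drop‿+<+ (subst₂ _<_ (a≡ i) (a≡ j) (a-mono i<j))

  inner : Fin ℓ → Fin (suc (suc ℓ))
  inner e = Fin.suc (inject₁ e)

  inner<top : ∀ e → inner e Fin.< top
  inner<top e = s≤s (subst (Fin.toℕ (inject₁ e) ℕ.<_) (sym (Fin.toℕ-fromℕ ℓ)) (Fin.inject₁ℕ< e))

  X Y : Fin ℓ → ℕ
  X e = ∣ a (inner e) ∣
  Y e = B ℕ.∸ X e

  X<B : ∀ e → X e ℕ.< B
  X<B e = ∣a∣-mono (inner<top e)

  system : System ℓ B
  system = record
    { X = X ; Y = Y
    ; X+Y≡b = λ e → ℕ.m+[n∸m]≡n (ℕ.<⇒≤ (X<B e))
    ; X>0 = λ e → subst (ℕ._< X e) (cong ∣_∣ a₀≡0) (∣a∣-mono {Fin.zero} {inner e} ℕ.z<s)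
    ; Y>0 = λ e → ℕ.m<n⇒0<n∸m (X<B e)
    ; X-injective = λ {e} {f} eq → inj eq
    }
    where
    inj : ∀ {e f} → X e ≡ X f → e ≡ f
    inj {e} {f} eq with Fin.<-cmp (inner e) (inner f)
    ... | tri< lt _ _ = contradiction eq (ℕ.<⇒≢ (∣a∣-mono lt))
    ... | tri≈ _ e≡f _ = Fin.inject₁-injective (Fin.suc-injective e≡f)
    ... | tri> _ _ gt = contradiction (sym eq) (ℕ.<⇒≢ (∣a∣-mono gt))

  spans : image a SpannedBy X , B
  spans z = mk⇔ (λ { (i , ai≡z) → subst (λ z → z ≡ 0ℤ ⊎ z ≡ + B ⊎ ∃ λ e → z ≡ + X e) ai≡z (cases i) })
    [ (λ z≡0 → Fin.zero , trans a₀≡0 (sym z≡0))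
    , [ (λ z≡B → top , trans (a≡ top) (sym z≡B)) , (λ { (e , z≡) → inner e , trans (a≡ (inner e)) (sym z≡) }) ]′ ]′
    where
    cases : ∀ i → a i ≡ 0ℤ ⊎ a i ≡ + B ⊎ ∃ λ e → a i ≡ + X e
    cases Fin.zero    = inj₁ a₀≡0
    cases (Fin.suc i) with view i
    ... | ‵fromℕ     = inj₂ (inj₁ (a≡ top))
    ... | ‵inject₁ e = inj₂ (inj₂ (e , a≡ (inner e)))

  spans′ : (a top ⊖ image a) SpannedBy Y , B
  spans′ z = mk⇔ fwd bwd
    where
    B-X : ∀ e → + B - + X e ≡ + Y e
    B-X e = trans (ℤ.m-n≡m⊖n B (X e)) (ℤ.⊖-≥ (ℕ.<⇒≤ (X<B e)))
    fwd : (a top ⊖ image a) z → z ≡ 0ℤ ⊎ z ≡ + B ⊎ ∃ λ e → z ≡ + Y e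
    fwd (s , s∈A , refl) with to (spans s) s∈A
    ... | inj₁ refl              = inj₂ (inj₁ (trans (ℤ.+-identityʳ (a top)) (a≡ top)))
    ... | inj₂ (inj₁ refl)       = inj₁ (ℤ.i≡j⇒i-j≡0 (a≡ top))
    ... | inj₂ (inj₂ (e , refl)) = inj₂ (inj₂ (e , trans (cong (λ t → t - + X e) (a≡ top)) (B-X e)))
    bwd : z ≡ 0ℤ ⊎ z ≡ + B ⊎ (∃ λ e → z ≡ + Y e) → (a top ⊖ image a) z
    bwd (inj₁ refl)              = a top , (top , refl) , ℤ.+-inverseʳ (a top)
    bwd (inj₂ (inj₁ refl))       = 0ℤ , (Fin.zero , a₀≡0) , trans (ℤ.+-identityʳ (a top)) (a≡ top)
    bwd (inj₂ (inj₂ (e , refl))) = + X e , (inner e , a≡ (inner e)) , trans (cong (λ t → t - + X e) (a≡ top)) (B-X e)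

-- The two inclusions.

p-[p-q]≡q : ∀ p q → p - (p - q) ≡ q
p-[p-q]≡q = solve-∀

theorem2 : (ℓ : ℕ) → 1 ℕ.≤ ℓ →
    (a : Vector ℤ (suc (suc ℓ))) (b : ℤ) →
    a Preserves Fin._<_ ⟶ _<_ →
    head a ≡ 0ℤ →
    a (fromℕ (suc ℓ)) ≡ b →
    gcdᵛ (tail a) ≡ 1ℤ →
    (N : ℕ) → 1ℤ ⊔ (b - + ℓ - 1ℤ) ≤ + N →
    let A = image a in
    ¬ ((FamilyI b A ⊎ FamilyII b A) ⊎ (FamilyI b (b ⊖ A) ⊎ FamilyII b (b ⊖ A))) →
    N · A ≐ [ 0ℤ ⋯ b * + N ] ∖ (𝓔 A ∪ ((b * + N) ⊖ 𝓔 (b ⊖ A)))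
theorem2 ℓ _ a b a-mono a₀≡0 refl _ N N≥ exceptional = ⊆ , ⊇
  where
  A  = image a
  open Interior a a-mono a₀≡0 using (a≡; ∣a∣-mono)
    renaming (B to B′; system to S; spans to A-spans; spans′ to A′-spans)
  open System S

  b≡B : b ≡ + B′
  b≡B = a≡ (fromℕ (suc ℓ))

  1≤N : 1 ℕ.≤ N
  1≤N = ℤ.drop‿+≤+ (ℤ.≤-trans (ℤ.i≤i⊔j 1ℤ _) N≥)

  B≤1+ℓ+N : B′ ℕ.≤ suc (ℓ ℕ.+ N)
  B≤1+ℓ+N = ℤ.drop‿+≤+ (subst₂ _≤_ (trans (cancel b (+ ℓ)) b≡B) (+-comm₃ (+ N) (+ ℓ))
    (ℤ.+-monoˡ-≤ (1ℤ + + ℓ) (ℤ.≤-trans (ℤ.i≤j⊔i 1ℤ _) N≥)))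
    where
    cancel : ∀ p q → (p - q - 1ℤ) + (1ℤ + q) ≡ p
    cancel = solve-∀
    +-comm₃ : ∀ p q → p + (1ℤ + q) ≡ 1ℤ + (q + p)
    +-comm₃ = solve-∀

  regular : Regular B′ X
  regular = (λ p → exceptional (inj₁ (inj₁ (subst (λ b → FamilyI b A) (sym b≡B)
                (Punctured⇒FamilyI A-spans X>0 X<b p)))))
          , (λ p → exceptional (inj₁ (inj₂ (subst (λ b → FamilyII b A) (sym b≡B)
                (Gapped⇒FamilyII A-spans X>0 X<b p)))))

  regular′ : Regular B′ Y
  regular′ = (λ p → exceptional (inj₂ (inj₁ (subst (λ c → FamilyI c (b ⊖ A)) (sym b≡B)
                (Punctured⇒FamilyI A′-spans Y>0 (System.X<b (mirror S)) p)))))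
           , (λ p → exceptional (inj₂ (inj₂ (subst (λ c → FamilyII c (b ⊖ A)) (sym b≡B)
                (Gapped⇒FamilyII A′-spans Y>0 (System.X<b (mirror S)) p)))))

  ⊆ : ∀ {x} → (N · A) x → ([ 0ℤ ⋯ b * + N ] ∖ (𝓔 A ∪ ((b * + N) ⊖ 𝓔 (b ⊖ A)))) x
  -- The upper bound on `x` is the nonnegativity of the reflected sum `b * + N - x`.
  ⊆ {x} x∈NA = (nonneg A-spans x∈NA , ℤ.0≤i-j⇒j≤i (nonneg A′-spans x′∈NA′)) , λ
    { (inj₁ (_ , x∉𝓟)) → x∉𝓟 (N , 1≤N , x∈NA)
    ; (inj₂ (s , (_ , s∉𝓟) , refl)) → s∉𝓟 (N , 1≤N , subst (N · (b ⊖ A)) (p-[p-q]≡q (b * + N) s) x′∈NA′) }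
    where
    x′∈NA′ : (N · (b ⊖ A)) (b * + N - x)
    x′∈NA′ = ·-reflect A b x∈NA
    nonneg : ∀ {A x} {f : Fin ℓ → ℕ} → A SpannedBy f , B′ → (N · A) x → 0ℤ ≤ x
    nonneg {f = f} sp x∈ with ·⇒list {f = f} sp N x∈
    ... | _ , _ , refl , _ = +≤+ z≤n

  ⊇ : ∀ {x} → ([ 0ℤ ⋯ b * + N ] ∖ (𝓔 A ∪ ((b * + N) ⊖ 𝓔 (b ⊖ A)))) x → (N · A) x
  -- Membership in `N · A` is decidable, so the doubly negated result suffices.
  ⊇ {x} ((0≤x , x≤bN) , x∉) = decidable-stable (·image? a N x) λ x∉NA →
    ∉𝓔⇒¬¬∈· {{ℕ.>-nonZero B>0}} S A-spans A′-spans regular regular′ N ∣ x ∣ ∣ b * + N - x ∣ total B≤1+ℓ+N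
      (λ x∈𝓔 → x∉ (inj₁ (subst (𝓔 A) ∣x∣≡x x∈𝓔)))
      (λ x′∈𝓔 → x∉ (inj₂ (b * + N - x , subst (𝓔 (b ⊖ A)) ∣x′∣≡x′ x′∈𝓔 , p-[p-q]≡q (b * + N) x)))
      (λ x∈NA → x∉NA (subst (N · A) ∣x∣≡x x∈NA))
    where
    ∣x∣≡x : + ∣ x ∣ ≡ x
    ∣x∣≡x = ℤ.0≤i⇒+∣i∣≡i 0≤x
    ∣x′∣≡x′ : + ∣ b * + N - x ∣ ≡ b * + N - x
    ∣x′∣≡x′ = ℤ.0≤i⇒+∣i∣≡i (ℤ.i≤j⇒0≤j-i x≤bN)
    cancel : ∀ p q → q + (p - q) ≡ p
    cancel = solve-∀
    total : ∣ x ∣ ℕ.+ ∣ b * + N - x ∣ ≡ N ℕ.* B′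
    total = ℤ.+-injective (begin
      + ∣ x ∣ + + ∣ b * + N - x ∣      ≡⟨ cong₂ _+_ ∣x∣≡x ∣x′∣≡x′ ⟩
      x + (b * + N - x)                ≡⟨ cancel (b * + N) x ⟩
      b * + N                          ≡⟨ cong (_* + N) b≡B ⟩
      + B′ * + N                       ≡⟨ ℤ.*-comm (+ B′) (+ N) ⟩
      + N * + B′                       ≡⟨ ℤ.pos-* N B′ ⟨
      + (N ℕ.* B′)                     ∎)
      where open ≡-Reasoning
    B>0 : 0 ℕ.< B′
    B>0 = subst (ℕ._< B′) (cong ∣_∣ a₀≡0) (∣a∣-mono {Fin.zero} {fromℕ (suc ℓ)} ℕ.z<s)
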